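{- Let $p$ be a prime, let $a_1, a_2, \ldots \in \mathbb{Z}_p$ and let $r \in \mathbb{Z}_{> 0}$. The power series $(1 + a_1 x + a_2 x^2 + \ldots)^{1/p^r}$ has all its coefficients in $\mathbb{Z}_p$ if and only if \[ 1 + a_1 x + a_2 x^2 + \ldots \equiv (1 + a_{p^r} x + a_{2 p^r} x^2 + \ldots)^{p^r} \pmod{p^{r + 1}} . \]
   Context: $\mathbb{Z}_p$ denotes the ring of $p$-adic integers and $\mathbb{Q}_p$ its fraction field. For $f(x) = 1 + a_1 x + a_2 x^2 + \ldots \in 1 + x\mathbb{Q}_p[[x]]$ and $\lambda \in \mathbb{Q}_p$, the power $f(x)^{\lambda}$ is the formal power series defined by the binomial expansion $f(x)^\lambda = \sum_{n \ge 0} \binom{\lambda}{n} (a_1 x + a_2 x^2 + \ldots)^n$, where $\binom{\lambda}{n} = \lambda(\lambda-1)\cdots(\lambda-n+1)/n!$. For $A, B \in \mathbb{Q}_p[[x]]$, the notation $A \equiv B \pmod{p^k}$ means $A - B \in p^k \mathbb{Z}_p[[x]]$. -}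

module Defs where

open import Data.Nat as ℕ using (ℕ; zero; suc; _∸_)
import Data.Nat.Divisibility as ℕD
open import Data.Integer as ℤ using (ℤ; +_)
open import Data.Integer.Divisibility using (_∣_)
open import Data.Product using (Σ; _×_; _,_)
open import Relation.Nullary using (yes; no)

-- ===================================================================
-- p-adic integers, modelled as (raw) sequences of integers x : ℕ → ℤ,
-- where x n represents the residue mod p^n.
-- ===================================================================

Seq : Set
Seq = ℕ → ℤ

IsZp : ℕ → Seq → Set
IsZp p x = ∀ n → + (p ℕ.^ n) ∣ (x (suc n) ℤ.- x n)

_≈[_]_ : Seq → ℕ → Seq → Set
x ≈[ p ] y = ∀ n → + (p ℕ.^ n) ∣ (x n ℤ.- y n)

_⊕_ : Seq → Seq → Seq
(x ⊕ y) n = x n ℤ.+ y n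

_⊗_ : Seq → Seq → Seq
(x ⊗ y) n = x n ℤ.* y n

⊖_ : Seq → Seq
(⊖ x) n = ℤ.- x n

const : ℤ → Seq
const c _ = c

zeroZ oneZ : Seq
zeroZ = const (+ 0)
oneZ  = const (+ 1)

ppow : ℕ → ℕ → Seq
ppow p e = const (+ (p ℕ.^ e))

-- inverse in ℤ_p of a natural number u prime to p (Euler: u^(φ(p^n) - 1) mod p^n)
invUnit : ℕ → ℕ → Seq
invUnit p u n = (+ u) ℤ.^ (p ℕ.^ n ∸ p ℕ.^ (n ∸ 1) ∸ 1)

-- ===================================================================
-- ℚ_p = ℤ_p[1/p]: a pair (z , m) represents z / p^m.
-- ===================================================================

Qp : Set
Qp = Seq × ℕ

ιQ : Seq → Qp
ιQ z = z , 0

addQ : ℕ → Qp → Qp → Qp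
addQ p (z , m) (w , k) = ((ppow p k ⊗ z) ⊕ (ppow p m ⊗ w)) , m ℕ.+ k

mulQ : Qp → Qp → Qp
mulQ (z , m) (w , k) = (z ⊗ w) , m ℕ.+ k

negQ : Qp → Qp
negQ (z , m) = (⊖ z) , m

natQ : ℕ → Qp
natQ n = ιQ (const (+ n))

-- Splitting d = p^v * u with p ∤ u (for d ≠ 0); the first argument is fuel.
splitP : ℕ → ℕ → ℕ → ℕ × ℕ
splitP p zero d = 0 , d
splitP p (suc f) zero = 0 , zero
splitP p (suc f) (suc d) with p ℕD.∣? suc d
... | yes (ℕD.divides q _) with splitP p f q
...   | v , u = suc v , u
splitP p (suc f) (suc d) | no _ = 0 , suc d

-- division in ℚ_p by a nonzero natural number d = p^v u:  x / d = x * u⁻¹ / p^v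
divNatQ : ℕ → Qp → ℕ → Qp
divNatQ p (z , m) d with splitP p d d
... | v , u = (z ⊗ invUnit p u) , m ℕ.+ v

fallingQ : ℕ → Qp → ℕ → Qp
fallingQ p λ' zero = natQ 1
fallingQ p λ' (suc n) = mulQ (fallingQ p λ' n) (addQ p λ' (negQ (natQ n)))

binomQ : ℕ → Qp → ℕ → Qp
binomQ p λ' n = divNatQ p (fallingQ p λ' n) (n ℕ.!)

invPpowQ : ℕ → Qp
invPpowQ r = oneZ , r

InZpQ : ℕ → Qp → Set
InZpQ p (z , m) = Σ Seq λ w → IsZp p w × (z ≈[ p ] (ppow p m ⊗ w))

Series : Set → Set
Series A = ℕ → A

sumZ : (ℕ → Seq) → ℕ → Seq
sumZ f zero = f 0
sumZ f (suc n) = sumZ f n ⊕ f (suc n)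

sumQ : ℕ → (ℕ → Qp) → ℕ → Qp
sumQ p f zero = f 0
sumQ p f (suc n) = addQ p (sumQ p f n) (f (suc n))

mulS : Series Seq → Series Seq → Series Seq
mulS f g n = sumZ (λ i → f i ⊗ g (n ∸ i)) n

oneS : Series Seq
oneS zero = oneZ
oneS (suc _) = zeroZ

powS : Series Seq → ℕ → Series Seq
powS f zero = oneS
powS f (suc k) = mulS (powS f k) f

onePlus : (ℕ → Seq) → Series Seq
onePlus a zero = oneZ
onePlus a (suc n) = a (suc n)

dropConst : Series Seq → Series Seq
dropConst f zero = zeroZ
dropConst f (suc n) = f (suc n)

-- f(x)^λ = Σ_{k ≥ 0} (λ choose k) (f - 1)^k.  Since f - 1 has no constant
-- term, the coefficient of x^n only receives contributions from k ≤ n.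
powQS : ℕ → Series Seq → Qp → Series Qp
powQS p f λ' n = sumQ p (λ k → mulQ (binomQ p λ' k) (ιQ (powS (dropConst f) k n))) n

IntegralSeries : ℕ → Series Qp → Set
IntegralSeries p F = ∀ n → InZpQ p (F n)

CongMod : ℕ → ℕ → Series Seq → Series Seq → Set
CongMod p k A B = ∀ n → Σ Seq λ w → IsZp p w × ((A n ⊕ (⊖ B n)) ≈[ p ] (ppow p k ⊗ w))

everyNth : Series Seq → ℕ → Series Seq
everyNth f m k = f (k ℕ.* m)

{-# OPTIONS --safe #-}

-- Write q = pʳ and G = f^(1/q), with h = Σ a_{kq} xᵏ.  The binomial series
-- solves (1+X) B′ = α B, so for α = 1/q its q-th power W solves (1+X) W′ = W,
-- which forces W = 1 + X; substituting f − 1 gives G^q = f over ℚ_p.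
-- If G is integral, then Frobenius and Fermat give (G^q)_{kq} ≡ G_k mod p, i.e.
-- h ≡ G mod p, and each p-th power improves a congruence by one power of p, so
-- h^q ≡ G^q = f mod p^{r+1}.  Conversely, for series with constant term 1 and H
-- integral, G^p ≡ H^p mod p^{k+2} implies G ≡ H mod p^{k+1}; applied r times to
-- G^q ≡ h^q mod p^{r+1} this yields G ≡ h mod p, so G is integral.
module Submission where

open import Defs
open import Algebra.Bundles using (CommutativeRing)
import Algebra.Properties.CommutativeMonoid.Mult as CMult
import Algebra.Properties.CommutativeSemiring.Binomial as Binomial
import Algebra.Properties.CommutativeSemiring.Exp as CExp
import Algebra.Properties.Group as GroupProperties
import Algebra.Properties.Ring as RingProperties
import Algebra.Properties.Semiring.Exp as Exp
import Algebra.Properties.Semiring.Mult as Mult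
import Algebra.Properties.Semiring.Sum as Sum
import Algebra.Solver.Ring.NaturalCoefficients.Default as NaturalCoefficients
open import Algebra.Structures using (IsCommutativeRing)
open import Data.Fin.Base as Fin using (Fin; toℕ; fromℕ; inject₁)
open import Data.Fin.Properties using (toℕ-fromℕ; toℕ-inject₁; toℕ<n)
import Data.Integer.Base as ℤ
open import Data.Integer.Divisibility.Signed as ℤD using (divides; ∣ᵤ⇒∣; ∣⇒∣ᵤ)
import Data.Integer.Properties as ℤP
open import Data.Integer.Tactic.RingSolver using (solve-∀)
open import Data.Nat.Base as ℕ using (ℕ; zero; suc; pred; _≤_; _<_; s≤s; z≤n; _∸_; _!)
open import Data.Nat.Combinatorics using (nCn≡1; nCk≡n!/k![n-k]!; k![n∸k]!∣n!) renaming (_C_ to _choose_)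
import Data.Nat.Divisibility as ℕD
import Data.Nat.DivMod as ℕDM
open import Data.Nat.Primality using (Prime; euclidsLemma; prime⇒nonTrivial; prime⇒nonZero)
import Data.Nat.Properties as ℕₚ
open import Data.Product.Base using (Σ; ∃; _×_; _,_; proj₁; proj₂)
open import Data.Sum.Base using (inj₁; inj₂)
open import Data.Vec.Functional using (Vector)
open import Function.Base using (_∘_)
open import Function.Bundles using (_⇔_; mk⇔; Equivalence)
open import Function.Properties.Equivalence using () renaming (sym to ⇔-sym; trans to ⇔-trans)
open import Level using (Level; 0ℓ; _⊔_) renaming (suc to lsuc)
open import Relation.Binary.PropositionalEquality as ≡ using (_≡_)
import Relation.Binary.Reasoning.Setoid as SetoidReasoning
open import Relation.Nullary using (¬_; contradiction; yes; no)

-- The modulus comes from the expansion (H + Δ)^p = H^p + p H^(p-1) Δ + Δ² T. If p^(k+1) divides Δ,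
-- then p^(2k+2), hence p^(k+2), divides the quadratic part, for p = 2 as well. So a p-th power
-- gains a factor p and a p-th root loses one, but only from exponent 1 upward: r roots must start
-- at p^(r+1) in order to end at p. In the converse G is not known to be integral, and Δ = G - H is
-- controlled only below the degree under consideration. Congruences are therefore set up in an
-- abstract filtered ring, and the series ring gets one filtration for each truncation degree; the
-- same lemmas on p-th powers then serve integers and truncated series. The differential equation
-- takes the place of Vandermonde-type identities: all it asks of the binomial coefficients is a
-- two-term recurrence. The statement speaks of raw sequences. The argument runs in ℤ_p[1/p], built
-- from coherent sequences by the same formulas, so that forgetting the coherence proofs gives back
-- the stated encoding.

-- Binomial coefficients modulo a prime.

prime⇒1<p : ∀ {p} → Prime p → 1 < p
prime⇒1<p {p} pr = ℕ.nonTrivial⇒n>1 p {{prime⇒nonTrivial pr}}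

prime∤! : ∀ {p} → Prime p → ∀ {n} → n < p → ¬ (p ℕD.∣ n !)
prime∤! pr {zero} n<p d = contradiction (ℕD.∣⇒≤ d) (ℕₚ.<⇒≱ (prime⇒1<p pr))
prime∤! pr {suc n} n<p d with euclidsLemma (suc n) (n !) pr d
... | inj₁ e = contradiction (ℕD.∣⇒≤ e) (ℕₚ.<⇒≱ n<p)
... | inj₂ e = prime∤! pr (ℕₚ.<-trans (ℕₚ.n<1+n n) n<p) e

prime∣choose : ∀ {p} → Prime p → ∀ {k} → 0 < k → k < p → p ℕD.∣ (p choose k)
prime∣choose {p@(suc p-1)} pr {k} 0<k k<p
  with euclidsLemma (p choose k) (k ! ℕ.* (p ∸ k) !) pr p∣
  where
  instance
    _ = k ℕₚ.!* (p ∸ k) !≢0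
  choose*k![p-k]!≡p! : (p choose k) ℕ.* (k ! ℕ.* (p ∸ k) !) ≡ p !
  choose*k![p-k]!≡p! = ≡.trans
    (≡.cong (ℕ._* (k ! ℕ.* (p ∸ k) !)) (nCk≡n!/k![n-k]! (ℕₚ.<⇒≤ k<p)))
    (ℕDM.m/n*n≡m (k![n∸k]!∣n! (ℕₚ.<⇒≤ k<p)))
  p∣ : p ℕD.∣ (p choose k) ℕ.* (k ! ℕ.* (p ∸ k) !)
  p∣ = ≡.subst (p ℕD.∣_) (≡.sym choose*k![p-k]!≡p!) (ℕD.m∣m*n (p-1 !))
... | inj₁ e = e
... | inj₂ e with euclidsLemma (k !) ((p ∸ k) !) pr e
...   | inj₁ e′ = contradiction e′ (prime∤! pr k<p)
...   | inj₂ e′ = contradiction e′ (prime∤! pr (ℕₚ.∸-monoʳ-< 0<k (ℕₚ.<⇒≤ k<p)))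

-- Filtered rings and congruences in them.

-- `F k` models p^k times the integral elements of S, so `F 0` may be a proper subring, as ℤ_p is in
-- ℚ_p. The converse of `F-p×`, division by p inside the filtration, is not built in: it becomes a
-- hypothesis where p-th roots are compared.
record Filtration {c ℓ : Level} (S : CommutativeRing c ℓ) (p : ℕ) (f : Level) : Set (c ⊔ ℓ ⊔ lsuc f) where
  open CommutativeRing S
  open Mult semiring using () renaming (_×_ to _×ₙ_)
  field
    F      : ℕ → Carrier → Set f
    F-resp : ∀ k {x y} → x ≈ y → F k x → F k y
    F-0#   : ∀ k → F k 0#
    F-1#   : F 0 1#
    F-+    : ∀ k {x y} → F k x → F k y → F k (x + y)
    F-neg  : ∀ k {x} → F k x → F k (- x)
    F-*    : ∀ k l {x y} → F k x → F l y → F (k ℕ.+ l) (x * y)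
    F-pred : ∀ k {x} → F (suc k) x → F k x
    F-p×   : ∀ k {x} → F k x → F (suc k) (p ×ₙ x)

module Filtered {c ℓ f : Level} (S : CommutativeRing c ℓ) (p : ℕ) (𝓕 : Filtration S p f) where

  open CommutativeRing S
  open Filtration 𝓕
  open Mult semiring renaming (_×_ to _×ₙ_)
  open Exp semiring
  open Sum semiring using (sum; sum-init-last)
  open NaturalCoefficients commutativeSemiring using (solve; _:=_; _:+_; _:*_; con)
  open RingProperties ring using (-‿+-comm)
  open SetoidReasoning setoid

  F-×ₙ : ∀ k n {x} → F k x → F k (n ×ₙ x)
  F-×ₙ k zero    x∈ = F-0# k
  F-×ₙ k (suc n) x∈ = F-+ k x∈ (F-×ₙ k n x∈)

  F-^ : ∀ n {x} → F 0 x → F 0 (x ^ n)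
  F-^ zero    x∈ = F-1#
  F-^ (suc n) x∈ = F-* 0 0 x∈ (F-^ n x∈)

  F-cast : ∀ {k l x} → k ≡ l → F k x → F l x
  F-cast ≡.refl x∈ = x∈

  F-drop : ∀ k n {x} → F (k ℕ.+ n) x → F n x
  F-drop zero    n x∈ = x∈
  F-drop (suc k) n x∈ = F-drop k n (F-pred (k ℕ.+ n) x∈)

  F-sum : ∀ k {n} (t : Vector Carrier n) → (∀ i → F k (t i)) → F k (sum t)
  F-sum k {zero}  t t∈ = F-0# k
  F-sum k {suc n} t t∈ = F-+ k (t∈ Fin.zero) (F-sum k (t ∘ Fin.suc) (t∈ ∘ Fin.suc))

  infix 4 _≡[_]_

  -- A congruence carries its difference as a witness and is stated with addition alone, so that the
  -- semiring solver, which knows no subtraction, applies to it.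
  record _≡[_]_ (x : Carrier) (k : ℕ) (y : Carrier) : Set (c ⊔ ℓ ⊔ f) where
    constructor differ-by
    field
      diff     : Carrier
      diff∈    : F k diff
      equation : x ≈ y + diff

  open _≡[_]_ public

  ≡[]-reflexive : ∀ k {x y} → x ≈ y → x ≡[ k ] y
  ≡[]-reflexive k x≈y = differ-by 0# (F-0# k) (trans x≈y (sym (+-identityʳ _)))

  ≡[]-sym : ∀ k {x y} → x ≡[ k ] y → y ≡[ k ] x
  ≡[]-sym k {x} {y} (differ-by d d∈ x≈y+d) = differ-by (- d) (F-neg k d∈) (begin
    y              ≈⟨ +-identityʳ y ⟨
    y + 0#         ≈⟨ +-congˡ (-‿inverseʳ d) ⟨
    y + (d - d)    ≈⟨ +-assoc y d (- d) ⟨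
    (y + d) - d    ≈⟨ +-congʳ x≈y+d ⟨
    x - d          ∎)

  ≡[]-trans : ∀ k {x y z} → x ≡[ k ] y → y ≡[ k ] z → x ≡[ k ] z
  ≡[]-trans k (differ-by d d∈ x≈y+d) (differ-by e e∈ y≈z+e) =
    differ-by (e + d) (F-+ k e∈ d∈) (trans x≈y+d (trans (+-congʳ y≈z+e) (+-assoc _ e d)))

  ≡[]-+-cong : ∀ k {x y u v} → x ≡[ k ] y → u ≡[ k ] v → x + u ≡[ k ] y + v
  ≡[]-+-cong k {x} {y} {u} {v} (differ-by d d∈ x≈y+d) (differ-by e e∈ u≈v+e) =
    differ-by (d + e) (F-+ k d∈ e∈) (trans (+-cong x≈y+d u≈v+e)
      (solve 4 (λ y d v e → (y :+ d) :+ (v :+ e) := (y :+ v) :+ (d :+ e)) refl y d v e))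

  ≡[]-*-congˡ : ∀ k {x y u} → F 0 u → x ≡[ k ] y → u * x ≡[ k ] u * y
  ≡[]-*-congˡ k u∈ (differ-by d d∈ x≈y+d) =
    differ-by _ (F-* 0 k u∈ d∈) (trans (*-congˡ x≈y+d) (distribˡ _ _ d))

  ≡[]-*-cong : ∀ k {x y u v} → F 0 u → F 0 y → x ≡[ k ] y → u ≡[ k ] v → x * u ≡[ k ] y * v
  ≡[]-*-cong k {x} {y} {u} {v} u∈ y∈ x≡y u≡v = ≡[]-trans k
    (≡[]-trans k (≡[]-reflexive k (*-comm x u))
      (≡[]-trans k (≡[]-*-congˡ k u∈ x≡y) (≡[]-reflexive k (*-comm u y))))
    (≡[]-*-congˡ k y∈ u≡v)

  ≡[]-neg-cong : ∀ k {x y} → x ≡[ k ] y → - x ≡[ k ] - y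
  ≡[]-neg-cong k (differ-by d d∈ x≈y+d) =
    differ-by (- d) (F-neg k d∈) (trans (-‿cong x≈y+d) (sym (-‿+-comm _ d)))

  ≡[]⇒F : ∀ k {x y} → x ≡[ k ] y → F k (x + - y)
  ≡[]⇒F k {x} {y} (differ-by d d∈ x≈y+d) = F-resp k (begin
    d                ≈⟨ +-identityʳ d ⟨
    d + 0#           ≈⟨ +-congˡ (-‿inverseʳ y) ⟨
    d + (y + - y)    ≈⟨ +-assoc d y (- y) ⟨
    (d + y) + - y    ≈⟨ +-congʳ (trans (+-comm d y) (sym x≈y+d)) ⟩
    x + - y          ∎) d∈

  F⇒≡[] : ∀ k {x y} → F k (x + - y) → x ≡[ k ] y
  F⇒≡[] k {x} {y} x-y∈ = differ-by (x + - y) x-y∈ (begin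
    x                ≈⟨ +-identityʳ x ⟨
    x + 0#           ≈⟨ +-congˡ (-‿inverseˡ y) ⟨
    x + (- y + y)    ≈⟨ +-assoc x (- y) y ⟨
    (x + - y) + y    ≈⟨ +-comm _ y ⟩
    y + (x + - y)    ∎)

  ≡[]-pred : ∀ k {x y} → x ≡[ suc k ] y → x ≡[ k ] y
  ≡[]-pred k (differ-by d d∈ x≈y+d) = differ-by d (F-pred k d∈) x≈y+d

  F-≡[] : ∀ k {x y} → x ≡[ k ] y → F k y → F k x
  F-≡[] k (differ-by d d∈ x≈y+d) y∈ = F-resp k (sym x≈y+d) (F-+ k y∈ d∈)

  -- Induction on n, multiplying by h + x. The point is that the cofactor t of x² is integral, so
  -- the remainder lies twice as deep in the filtration as x. At n = 0 the value of `pred` is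
  -- harmless, since the linear term is taken zero times.
  taylor : ∀ n {h x} → F 0 h → F 0 x →
           ∃ λ t → F 0 t × (h + x) ^ n ≈ h ^ n + (n ×ₙ (h ^ pred n * x) + x * x * t)
  taylor zero {h} {x} h∈ x∈ =
    0# , F-0# 0 , solve 1 (λ x → con 1 := con 1 :+ (con 0 :+ x :* x :* con 0)) refl x
  taylor (suc zero) {h} {x} h∈ x∈ =
    0# , F-0# 0 , solve 2 (λ h x → (h :+ x) :* con 1
      := h :* con 1 :+ ((con 1 :* x :+ con 0) :+ x :* x :* con 0)) refl h x
  -- The exponent 1 is treated separately so that n is a successor here and h^n unfolds to h · h^m.
  taylor (suc n@(suc m)) {h} {x} h∈ x∈ =
    let (t , t∈ , eq) = taylor n h∈ x∈
        a = h ^ m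
        b = n ×ₙ a
    in h * t + (b + x * t)
     , F-+ 0 (F-* 0 0 h∈ t∈) (F-+ 0 (F-×ₙ 0 n (F-^ m h∈)) (F-* 0 0 x∈ t∈))
     , (begin
       (h + x) * (h + x) ^ n
         ≈⟨ *-congˡ eq ⟩
       (h + x) * (h * a + (n ×ₙ (a * x) + x * x * t))
         ≈⟨ *-congˡ (+-congˡ (+-congʳ (×-assoc-* n a x))) ⟨
       (h + x) * (h * a + (b * x + x * x * t))
         ≈⟨ solve 5 (λ h x a b t →
              (h :+ x) :* (h :* a :+ (b :* x :+ x :* x :* t)) :=
              h :* (h :* a) :+ ((h :* a :* x :+ (h :* b) :* x) :+ x :* x :* (h :* t :+ (b :+ x :* t))))
              refl h x a b t ⟩
       h * (h * a) + ((h * a * x + (h * b) * x) + x * x * (h * t + (b + x * t)))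
         ≈⟨ +-congˡ (+-congʳ (+-congˡ (trans (*-congʳ (×-comm-* n h a)) (×-assoc-* n (h * a) x)))) ⟩
       h * (h * a) + ((h * a * x + n ×ₙ (h * a * x)) + x * x * (h * t + (b + x * t)))
         ∎)

  -- For x = y + d the linear term p y^(p-1) d gains a level from the factor p, and d² t lies at
  -- level 2k + 2, which is at least k + 2. The index `suc k` matters: at level 0 squaring d would
  -- gain nothing.
  ^p-cong : ∀ k {x y} → F 0 y → x ≡[ suc k ] y → x ^ p ≡[ suc (suc k) ] y ^ p
  ^p-cong k {x} {y} y∈ (differ-by d d∈ x≈y+d) =
    let (t , t∈ , eq) = taylor p y∈ (F₀ d∈)
        d²t∈ = F-* (suc k ℕ.+ suc k) 0 (F-* (suc k) (suc k) d∈ d∈) t∈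
    in differ-by _
         (F-+ (2 ℕ.+ k)
           (F-p× (suc k) (F-* 0 (suc k) (F-^ (pred p) y∈) d∈))
           (F-drop k (2 ℕ.+ k) (F-cast (index k) d²t∈)))
         (trans (^-congˡ p x≈y+d) eq)
    where
    F₀ : ∀ {z} → F (suc k) z → F 0 z
    F₀ z∈ = F-drop (suc k) 0 (F-cast (≡.sym (ℕₚ.+-identityʳ (suc k))) z∈)
    index : ∀ k → (suc k ℕ.+ suc k) ℕ.+ 0 ≡ k ℕ.+ (2 ℕ.+ k)
    index k = ≡.trans (ℕₚ.+-identityʳ _)
      (≡.trans (≡.cong suc (ℕₚ.+-suc k k))
        (≡.sym (≡.trans (ℕₚ.+-suc k (suc k)) (≡.cong suc (ℕₚ.+-suc k k)))))

  ^p^-suc : ∀ r x → x ^ (p ℕ.^ suc r) ≈ (x ^ (p ℕ.^ r)) ^ p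
  ^p^-suc r x = trans (^-congʳ x (ℕₚ.*-comm p (p ℕ.^ r))) (sym (^-assocʳ x (p ℕ.^ r) p))

  ^p^-cong : ∀ r k {x y} → F 0 y → x ≡[ suc k ] y →
             x ^ (p ℕ.^ r) ≡[ suc (r ℕ.+ k) ] y ^ (p ℕ.^ r)
  ^p^-cong zero k {x} {y} y∈ x≡y =
    ≡[]-trans (suc k) (≡[]-reflexive (suc k) (*-identityʳ x))
      (≡[]-trans (suc k) x≡y (≡[]-reflexive (suc k) (sym (*-identityʳ y))))
  ^p^-cong (suc r) k {x} {y} y∈ x≡y =
    ≡[]-trans _ (≡[]-reflexive _ (^p^-suc r x))
      (≡[]-trans _ (^p-cong (r ℕ.+ k) (F-^ (p ℕ.^ r) y∈) (^p^-cong r k y∈ x≡y))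
        (≡[]-reflexive _ (sym (^p^-suc r y))))

  F-∣×ₙ : ∀ k {m x} → p ℕD.∣ m → F k x → F (suc k) (m ×ₙ x)
  F-∣×ₙ k {x = x} (ℕD.divides q ≡.refl) x∈ =
    F-resp (suc k) (×-assocˡ x q p) (F-×ₙ (suc k) q (F-p× k x∈))

  freshman : Prime p → ∀ {x y} → F 0 x → F 0 y → (x + y) ^ p ≡[ 1 ] x ^ p + y ^ p
  freshman pr {x} {y} x∈ y∈ = expand p ≡.refl
    where
    open Binomial commutativeSemiring using (binomialTerm; theorem)
    -- Matching on a variable equal to p exposes p as a successor, which separates the two outer
    -- terms of the binomial sum from the n inner ones, all divisible by p.
    expand : ∀ n → n ≡ p → (x + y) ^ n ≡[ 1 ] x ^ n + y ^ n
    expand zero    0≡p    = contradiction (≡.subst (1 <_) (≡.sym 0≡p) (prime⇒1<p pr)) λ ()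
    expand (suc n) ≡.refl = differ-by (sum inner) (F-sum 1 inner inner∈) (begin
      (x + y) ^ p                                    ≈⟨ theorem p x y ⟩
      term Fin.zero + sum (term ∘ Fin.suc)           ≈⟨ +-congˡ (sum-init-last (term ∘ Fin.suc)) ⟩
      term Fin.zero + (sum inner + term top)         ≈⟨ +-cong first (+-congˡ final) ⟩
      y ^ p + (sum inner + x ^ p)                    ≈⟨ solve 3 (λ a b c → b :+ (c :+ a) := (a :+ b) :+ c)
                                                          refl (x ^ p) (y ^ p) (sum inner) ⟩
      x ^ p + y ^ p + sum inner                      ∎)
      where
      term = binomialTerm x y p
      top : Fin (suc p)
      top = Fin.suc (fromℕ n)
      inner : Vector Carrier n
      inner i = term (Fin.suc (inject₁ i))
      first : term Fin.zero ≈ y ^ p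
      first = trans (×-homo-1 _) (*-identityˡ _)
      final : term top ≈ x ^ p
      final rewrite toℕ-fromℕ n | nCn≡1 p | ℕₚ.n∸n≡0 n = trans (×-homo-1 _) (*-identityʳ _)
      inner∈ : ∀ i → F 1 (inner i)
      inner∈ i = F-∣×ₙ 0
        (prime∣choose pr (s≤s z≤n) (s≤s (≡.subst (_< n) (≡.sym (toℕ-inject₁ i)) (toℕ<n i))))
        (F-* 0 0 (F-^ (suc (toℕ (inject₁ i))) x∈) (F-^ (p ∸ suc (toℕ (inject₁ i))) y∈))

  freshman^ : Prime p → ∀ r {x y} → F 0 x → F 0 y →
              (x + y) ^ (p ℕ.^ r) ≡[ 1 ] x ^ (p ℕ.^ r) + y ^ (p ℕ.^ r)
  freshman^ pr zero {x} {y} x∈ y∈ =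
    ≡[]-reflexive 1 (trans (*-identityʳ _) (sym (+-cong (*-identityʳ x) (*-identityʳ y))))
  freshman^ pr (suc r) {x} {y} x∈ y∈ =
    ≡[]-trans 1 (≡[]-reflexive 1 (^p^-suc r (x + y)))
      (≡[]-trans 1 (≡[]-pred 1 (^p-cong 0 (F-+ 0 xʳ∈ yʳ∈) (freshman^ pr r x∈ y∈)))
        (≡[]-trans 1 (freshman pr xʳ∈ yʳ∈)
          (≡[]-reflexive 1 (sym (+-cong (^p^-suc r x) (^p^-suc r y))))))
    where
    xʳ∈ = F-^ (p ℕ.^ r) x∈
    yʳ∈ = F-^ (p ℕ.^ r) y∈

  -- Fermat is an assumption on `F 0` modulo `F 1`: it holds for ℤ_p, whose residue field has p
  -- elements, but fails for power series, where only the freshman's dream survives.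
  fermat^ : (∀ {x} → F 0 x → x ^ p ≡[ 1 ] x) → ∀ r {x} → F 0 x → x ^ (p ℕ.^ r) ≡[ 1 ] x
  fermat^ fermat zero    x∈ = ≡[]-reflexive 1 (*-identityʳ _)
  fermat^ fermat (suc r) x∈ =
    ≡[]-trans 1 (≡[]-reflexive 1 (^p^-suc r _))
      (≡[]-trans 1 (fermat (F-^ (p ℕ.^ r) x∈)) (fermat^ fermat r x∈))

-- Formal power series over a commutative ring.

module PowerSeries {ℓ : Level} (K : CommutativeRing 0ℓ ℓ) where

  open CommutativeRing K
  open Mult semiring renaming (_×_ to _×ₙ_)
  open CMult +-commutativeMonoid using (×-distrib-+)
  open NaturalCoefficients commutativeSemiring using (solve; _:=_; _:+_; _:*_; con)
  open SetoidReasoning setoid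

  infix  4 _≈ₛ_
  infixl 6 _+ₛ_
  infixl 7 _*ₛ_ _·ₛ_

  _≈ₛ_ : Series Carrier → Series Carrier → Set ℓ
  A ≈ₛ B = ∀ n → A n ≈ B n

  0ₛ 1ₛ : Series Carrier
  0ₛ _       = 0#
  1ₛ zero    = 1#
  1ₛ (suc _) = 0#

  1+X : Series Carrier
  1+X zero    = 1#
  1+X (suc n) = 1ₛ n

  tail : Series Carrier → Series Carrier
  tail A n = A (suc n)

  -- The product follows A = A(0) + X · `tail A`, so that the ring laws come out by structural
  -- induction on the degree; `convolution` recovers the usual finite sum.
  _+ₛ_ _*ₛ_ : Series Carrier → Series Carrier → Series Carrier
  (A +ₛ B) n       = A n + B n
  (A *ₛ B) zero    = A 0 * B 0
  (A *ₛ B) (suc n) = A 0 * B (suc n) + (tail A *ₛ B) n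

  -ₛ_ : Series Carrier → Series Carrier
  (-ₛ A) n = - A n

  _·ₛ_ : Carrier → Series Carrier → Series Carrier
  (a ·ₛ A) n = a * A n

  -- Locality in the degree is what lets an induction on the degree pass under a product.
  *ₛ-cong-≤ : ∀ n {A B C D} → (∀ j → j ≤ n → A j ≈ B j) → (∀ j → j ≤ n → C j ≈ D j) →
              (A *ₛ C) n ≈ (B *ₛ D) n
  *ₛ-cong-≤ zero    A≈B C≈D = *-cong (A≈B 0 z≤n) (C≈D 0 z≤n)
  *ₛ-cong-≤ (suc n) A≈B C≈D = +-cong (*-cong (A≈B 0 z≤n) (C≈D (suc n) ℕₚ.≤-refl))
    (*ₛ-cong-≤ n (λ j j≤n → A≈B (suc j) (s≤s j≤n)) (λ j j≤n → C≈D j (ℕₚ.m≤n⇒m≤1+n j≤n)))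

  *ₛ-cong : ∀ {A B C D} → A ≈ₛ B → C ≈ₛ D → A *ₛ C ≈ₛ B *ₛ D
  *ₛ-cong A≈B C≈D n = *ₛ-cong-≤ n (λ j _ → A≈B j) (λ j _ → C≈D j)

  *ₛ-distribʳ : ∀ C A B → (A +ₛ B) *ₛ C ≈ₛ A *ₛ C +ₛ B *ₛ C
  *ₛ-distribʳ C A B zero    = distribʳ _ _ _
  *ₛ-distribʳ C A B (suc n) = begin
    (A 0 + B 0) * C (suc n) + ((tail A +ₛ tail B) *ₛ C) n
      ≈⟨ +-congˡ (*ₛ-distribʳ C (tail A) (tail B) n) ⟩
    (A 0 + B 0) * C (suc n) + ((tail A *ₛ C) n + (tail B *ₛ C) n)
      ≈⟨ solve 5 (λ a b c u v → (a :+ b) :* c :+ (u :+ v) := (a :* c :+ u) :+ (b :* c :+ v)) refl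
           (A 0) (B 0) (C (suc n)) ((tail A *ₛ C) n) ((tail B *ₛ C) n) ⟩
    (A *ₛ C) (suc n) + (B *ₛ C) (suc n) ∎

  ·ₛ-*ₛ-assoc : ∀ a A B → (a ·ₛ A) *ₛ B ≈ₛ a ·ₛ (A *ₛ B)
  ·ₛ-*ₛ-assoc a A B zero    = *-assoc _ _ _
  ·ₛ-*ₛ-assoc a A B (suc n) =
    trans (+-cong (*-assoc _ _ _) (·ₛ-*ₛ-assoc a (tail A) B n)) (sym (distribˡ a _ _))

  -- The defining recursion peels the left factor; this mirror image peels the right one, and the
  -- two together give commutativity.
  *ₛ-suc : ∀ A B n → (A *ₛ B) (suc n) ≈ A (suc n) * B 0 + (A *ₛ tail B) n
  *ₛ-suc A B zero    = +-comm _ _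
  *ₛ-suc A B (suc n) = begin
    A 0 * B (2 ℕ.+ n) + (tail A *ₛ B) (suc n)
      ≈⟨ +-congˡ (*ₛ-suc (tail A) B n) ⟩
    A 0 * B (2 ℕ.+ n) + (A (2 ℕ.+ n) * B 0 + (tail A *ₛ tail B) n)
      ≈⟨ solve 3 (λ a b c → a :+ (b :+ c) := b :+ (a :+ c)) refl _ _ _ ⟩
    A (2 ℕ.+ n) * B 0 + (A *ₛ tail B) (suc n) ∎

  *ₛ-comm : ∀ A B → A *ₛ B ≈ₛ B *ₛ A
  *ₛ-comm A B zero    = *-comm _ _
  *ₛ-comm A B (suc n) =
    trans (+-cong (*-comm _ _) (*ₛ-comm (tail A) B n)) (sym (*ₛ-suc B A n))

  *ₛ-assoc : ∀ A B C → (A *ₛ B) *ₛ C ≈ₛ A *ₛ (B *ₛ C)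
  *ₛ-assoc A B C zero    = *-assoc _ _ _
  *ₛ-assoc A B C (suc n) = begin
    A 0 * B 0 * C (suc n) + ((A 0 ·ₛ tail B +ₛ tail A *ₛ B) *ₛ C) n
      ≈⟨ +-congˡ (*ₛ-distribʳ C (A 0 ·ₛ tail B) (tail A *ₛ B) n) ⟩
    A 0 * B 0 * C (suc n) + (((A 0 ·ₛ tail B) *ₛ C) n + ((tail A *ₛ B) *ₛ C) n)
      ≈⟨ +-congˡ (+-cong (·ₛ-*ₛ-assoc (A 0) (tail B) C n) (*ₛ-assoc (tail A) B C n)) ⟩
    A 0 * B 0 * C (suc n) + (A 0 * (tail B *ₛ C) n + (tail A *ₛ (B *ₛ C)) n)
      ≈⟨ solve 5 (λ a b c d e → a :* b :* c :+ (a :* d :+ e) := a :* (b :* c :+ d) :+ e) refl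
           (A 0) (B 0) (C (suc n)) ((tail B *ₛ C) n) ((tail A *ₛ (B *ₛ C)) n) ⟩
    (A *ₛ (B *ₛ C)) (suc n) ∎

  *ₛ-zeroˡ : ∀ A → 0ₛ *ₛ A ≈ₛ 0ₛ
  *ₛ-zeroˡ A zero    = zeroˡ _
  *ₛ-zeroˡ A (suc n) = trans (+-cong (zeroˡ _) (*ₛ-zeroˡ A n)) (+-identityˡ 0#)

  *ₛ-identityˡ : ∀ A → 1ₛ *ₛ A ≈ₛ A
  *ₛ-identityˡ A zero    = *-identityˡ _
  *ₛ-identityˡ A (suc n) =
    trans (+-cong (*-identityˡ _) (*ₛ-zeroˡ A n)) (+-identityʳ _)

  *ₛ-identityʳ : ∀ A → A *ₛ 1ₛ ≈ₛ A
  *ₛ-identityʳ A n = trans (*ₛ-comm A 1ₛ n) (*ₛ-identityˡ A n)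

  *ₛ-distribˡ : ∀ C A B → C *ₛ (A +ₛ B) ≈ₛ C *ₛ A +ₛ C *ₛ B
  *ₛ-distribˡ C A B n = trans (*ₛ-comm C (A +ₛ B) n)
    (trans (*ₛ-distribʳ C A B n) (+-cong (*ₛ-comm A C n) (*ₛ-comm B C n)))

  series-isCommutativeRing : IsCommutativeRing _≈ₛ_ _+ₛ_ _*ₛ_ -ₛ_ 0ₛ 1ₛ
  series-isCommutativeRing = record
    { isRing = record
      { +-isAbelianGroup = record
        { isGroup = record
          { isMonoid = record
            { isSemigroup = record
              { isMagma = record
                { isEquivalence = record
                  { refl  = λ n → refl
                  ; sym   = λ e n → sym (e n)
                  ; trans = λ d e n → trans (d n) (e n)
                  }
                ; ∙-cong = λ d e n → +-cong (d n) (e n)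
                }
              ; assoc = λ A B C n → +-assoc _ _ _
              }
            ; identity = (λ A n → +-identityˡ _) , (λ A n → +-identityʳ _)
            }
          ; inverse = (λ A n → -‿inverseˡ _) , (λ A n → -‿inverseʳ _)
          ; ⁻¹-cong = λ e n → -‿cong (e n)
          }
        ; comm = λ A B n → +-comm _ _
        }
      ; *-cong     = *ₛ-cong
      ; *-assoc    = *ₛ-assoc
      ; *-identity = *ₛ-identityˡ , *ₛ-identityʳ
      ; distrib    = *ₛ-distribˡ , *ₛ-distribʳ
      }
    ; *-comm = *ₛ-comm
    }

  seriesRing : CommutativeRing 0ℓ ℓ
  seriesRing = record { isCommutativeRing = series-isCommutativeRing }

  private module 𝕊 = CommutativeRing seriesRing
  open Exp 𝕊.semiring using () renaming (_^_ to _^ₛ_)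
  open Mult 𝕊.semiring using () renaming (_×_ to _×ₛ_; ×-comm-* to ×ₛ-comm-*; ×-congʳ to ×ₛ-congʳ)

  ×ₛ-coeff : ∀ m A n → (m ×ₛ A) n ≡ m ×ₙ A n
  ×ₛ-coeff zero    A n = ≡.refl
  ×ₛ-coeff (suc m) A n = ≡.cong (A n +_) (×ₛ-coeff m A n)

  ×-zeroʳ : ∀ m → m ×ₙ 0# ≈ 0#
  ×-zeroʳ m = trans (sym (×-congʳ m (zeroˡ 0#))) (trans (sym (×-assoc-* m 0# 0#)) (zeroʳ _))

  tail-*ₛ : ∀ A B → A 0 ≈ 0# → ∀ n → (A *ₛ B) (suc n) ≈ (tail A *ₛ B) n
  tail-*ₛ A B A₀≈0 n = trans (+-congʳ (trans (*-congʳ A₀≈0) (zeroˡ _))) (+-identityˡ _)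

  sumUpTo : (ℕ → Carrier) → ℕ → Carrier
  sumUpTo t zero    = t 0
  sumUpTo t (suc n) = sumUpTo t n + t (suc n)

  sumUpTo-cong-≤ : ∀ n {t u} → (∀ j → j ≤ n → t j ≈ u j) → sumUpTo t n ≈ sumUpTo u n
  sumUpTo-cong-≤ zero    t≈u = t≈u 0 z≤n
  sumUpTo-cong-≤ (suc n) t≈u =
    +-cong (sumUpTo-cong-≤ n (λ j j≤n → t≈u j (ℕₚ.m≤n⇒m≤1+n j≤n))) (t≈u (suc n) ℕₚ.≤-refl)

  convolution : ∀ A B n → sumUpTo (λ i → A i * B (n ∸ i)) n ≈ (A *ₛ B) n
  convolution A B zero    = refl
  convolution A B (suc n) = begin
    sumUpTo (λ i → A i * B (suc n ∸ i)) n + A (suc n) * B (n ∸ n)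
      ≈⟨ +-cong (sumUpTo-cong-≤ n λ j j≤n → *-congˡ (reflexive (≡.cong B (ℕₚ.+-∸-assoc 1 j≤n))))
           (*-congˡ (reflexive (≡.cong B (ℕₚ.n∸n≡0 n)))) ⟩
    sumUpTo (λ i → A i * tail B (n ∸ i)) n + A (suc n) * B 0
      ≈⟨ +-congʳ (convolution A (tail B) n) ⟩
    (A *ₛ tail B) n + A (suc n) * B 0
      ≈⟨ +-comm _ _ ⟩
    A (suc n) * B 0 + (A *ₛ tail B) n
      ≈⟨ *ₛ-suc A B n ⟨
    (A *ₛ B) (suc n) ∎

  -- Substitution of a series without constant term

  partial : Series Carrier → Series Carrier → ℕ → Series Carrier
  partial B y zero    = B 0 ·ₛ 1ₛ
  partial B y (suc N) = partial B y N +ₛ B (suc N) ·ₛ (y ^ₛ suc N)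

  -- Cutting the sum at k = n in degree n is the truncation used by `powQS`. It loses nothing when y
  -- has no constant term, by `partial-stable`.
  comp : Series Carrier → Series Carrier → Series Carrier
  comp B y n = partial B y n n

  ·ₛ-*ₛ-comm : ∀ a A B → A *ₛ (a ·ₛ B) ≈ₛ a ·ₛ (A *ₛ B)
  ·ₛ-*ₛ-comm a A B n = begin
    (A *ₛ (a ·ₛ B)) n  ≈⟨ *ₛ-comm A (a ·ₛ B) n ⟩
    ((a ·ₛ B) *ₛ A) n  ≈⟨ ·ₛ-*ₛ-assoc a B A n ⟩
    a * (B *ₛ A) n     ≈⟨ *-congˡ (*ₛ-comm B A n) ⟩
    a * (A *ₛ B) n     ∎

  -- Horner's scheme: every summand after the first contains a factor y. It turns the finite sum
  -- into a recursion along `tail B`.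
  horner : ∀ N B y → partial B y (suc N) ≈ₛ B 0 ·ₛ 1ₛ +ₛ y *ₛ partial (tail B) y N
  horner zero    B y n = +-congˡ (sym (·ₛ-*ₛ-comm (B 1) y 1ₛ n))
  horner (suc N) B y n = begin
    partial B y (suc N) n + B (2 ℕ.+ N) * (y ^ₛ (2 ℕ.+ N)) n
      ≈⟨ +-cong (horner N B y n) (sym (·ₛ-*ₛ-comm (B (2 ℕ.+ N)) y (y ^ₛ suc N) n)) ⟩
    (B 0 ·ₛ 1ₛ) n + (y *ₛ partial (tail B) y N) n + (y *ₛ (B (2 ℕ.+ N) ·ₛ (y ^ₛ suc N))) n
      ≈⟨ +-assoc _ _ _ ⟩
    (B 0 ·ₛ 1ₛ) n + ((y *ₛ partial (tail B) y N) n + (y *ₛ (B (2 ℕ.+ N) ·ₛ (y ^ₛ suc N))) n)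
      ≈⟨ +-congˡ (*ₛ-distribˡ y (partial (tail B) y N) (B (2 ℕ.+ N) ·ₛ (y ^ₛ suc N)) n) ⟨
    (B 0 ·ₛ 1ₛ) n + (y *ₛ partial (tail B) y (suc N)) n ∎

  partial-sum : ∀ B y N n → partial B y N n ≈ sumUpTo (λ k → B k * (y ^ₛ k) n) N
  partial-sum B y zero    n = refl
  partial-sum B y (suc N) n = +-congʳ (partial-sum B y N n)

  module _ {y : Series Carrier} (y₀≈0 : y 0 ≈ 0#) where

    private u = tail y

    ^ₛ-order : ∀ k {n} → n < k → (y ^ₛ k) n ≈ 0#
    ^ₛ-order (suc k) {zero}  _         = trans (*-congʳ y₀≈0) (zeroˡ _)
    ^ₛ-order (suc k) {suc n} (s≤s n<k) = begin
      (y *ₛ (y ^ₛ k)) (suc n)  ≈⟨ tail-*ₛ y (y ^ₛ k) y₀≈0 n ⟩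
      (u *ₛ (y ^ₛ k)) n        ≈⟨ *ₛ-cong-≤ n (λ _ _ → refl) (λ j j≤n → ^ₛ-order k (ℕₚ.≤-<-trans j≤n n<k)) ⟩
      (u *ₛ 0ₛ) n              ≈⟨ *ₛ-comm u 0ₛ n ⟩
      (0ₛ *ₛ u) n              ≈⟨ *ₛ-zeroˡ u n ⟩
      0#                       ∎

    -- Powers y^k with k > n start above degree n, so lengthening the sum has no effect there.
    partial-stable : ∀ B N n → n ≤ N → partial B y N n ≈ comp B y n
    partial-stable B N n n≤N with ℕₚ.m≤n⇒m<n∨m≡n n≤N
    partial-stable B N       n _ | inj₂ ≡.refl    = refl
    partial-stable B (suc N) n _ | inj₁ (s≤s n≤N) = begin
      partial B y N n + B (suc N) * (y ^ₛ suc N) n  ≈⟨ +-congˡ (*-congˡ (^ₛ-order (suc N) (s≤s n≤N))) ⟩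
      partial B y N n + B (suc N) * 0#              ≈⟨ +-congˡ (zeroʳ _) ⟩
      partial B y N n + 0#                          ≈⟨ +-identityʳ _ ⟩
      partial B y N n                               ≈⟨ partial-stable B N n n≤N ⟩
      comp B y n                                    ∎

    comp-zero : ∀ B → comp B y 0 ≈ B 0
    comp-zero B = *-identityʳ (B 0)

    -- B(y) = B(0) + y · (`tail B`)(y), and y = X u; dividing by X lowers the degree by one.
    comp-suc : ∀ B n → comp B y (suc n) ≈ (u *ₛ comp (tail B) y) n
    comp-suc B n = begin
      partial B y (suc n) (suc n)
        ≈⟨ horner n B y (suc n) ⟩
      B 0 * 0# + (y *ₛ partial (tail B) y n) (suc n)
        ≈⟨ +-cong (zeroʳ _) (tail-*ₛ y (partial (tail B) y n) y₀≈0 n) ⟩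
      0# + (u *ₛ partial (tail B) y n) n
        ≈⟨ +-identityˡ _ ⟩
      (u *ₛ partial (tail B) y n) n
        ≈⟨ *ₛ-cong-≤ n (λ _ _ → refl) (partial-stable (tail B) n) ⟩
      (u *ₛ comp (tail B) y) n ∎

    -- Since y has no constant term, comp-suc reduces an identity between
    -- compositions to the same identity in lower degrees.

    comp-cong-≤ : ∀ N n → n ≤ N → ∀ {A B} → A ≈ₛ B → comp A y n ≈ comp B y n
    comp-cong-≤ N       zero    _         A≈B = *-congʳ (A≈B 0)
    comp-cong-≤ (suc N) (suc n) (s≤s n≤N) {A} {B} A≈B = begin
      comp A y (suc n)          ≈⟨ comp-suc A n ⟩
      (u *ₛ comp (tail A) y) n  ≈⟨ *ₛ-cong-≤ n (λ _ _ → refl)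
        (λ j j≤n → comp-cong-≤ N j (ℕₚ.≤-trans j≤n n≤N) (A≈B ∘ suc)) ⟩
      (u *ₛ comp (tail B) y) n  ≈⟨ comp-suc B n ⟨
      comp B y (suc n)          ∎

    comp-cong : ∀ {A B} → A ≈ₛ B → comp A y ≈ₛ comp B y
    comp-cong A≈B n = comp-cong-≤ n n ℕₚ.≤-refl A≈B

    comp-linear-≤ : ∀ N n → n ≤ N → ∀ a A B → comp (a ·ₛ A +ₛ B) y n ≈ (a ·ₛ comp A y +ₛ comp B y) n
    comp-linear-≤ N zero _ a A B = begin
      (a * A 0 + B 0) * 1#         ≈⟨ distribʳ _ _ _ ⟩
      a * A 0 * 1# + B 0 * 1#      ≈⟨ +-congʳ (*-assoc _ _ _) ⟩
      a * (A 0 * 1#) + B 0 * 1#    ∎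
    comp-linear-≤ (suc N) (suc n) (s≤s n≤N) a A B = begin
      comp (a ·ₛ A +ₛ B) y (suc n)
        ≈⟨ comp-suc (a ·ₛ A +ₛ B) n ⟩
      (u *ₛ comp (a ·ₛ tail A +ₛ tail B) y) n
        ≈⟨ *ₛ-cong-≤ n (λ _ _ → refl)
             (λ j j≤n → comp-linear-≤ N j (ℕₚ.≤-trans j≤n n≤N) a (tail A) (tail B)) ⟩
      (u *ₛ (a ·ₛ comp (tail A) y +ₛ comp (tail B) y)) n
        ≈⟨ *ₛ-distribˡ u (a ·ₛ comp (tail A) y) (comp (tail B) y) n ⟩
      (u *ₛ (a ·ₛ comp (tail A) y)) n + (u *ₛ comp (tail B) y) n
        ≈⟨ +-congʳ (·ₛ-*ₛ-comm a u (comp (tail A) y) n) ⟩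
      a * (u *ₛ comp (tail A) y) n + (u *ₛ comp (tail B) y) n
        ≈⟨ +-cong (*-congˡ (comp-suc A n)) (comp-suc B n) ⟨
      a * comp A y (suc n) + comp B y (suc n) ∎

    -- The tail of a product is A(0) · `tail B` + `tail A` · B, so linearity of the substitution
    -- handles the sum and induction the second product. The bound N is the recursion measure,
    -- because the induction hypothesis is needed at every j ≤ n.
    comp-*ₛ-≤ : ∀ N n → n ≤ N → ∀ A B → comp (A *ₛ B) y n ≈ (comp A y *ₛ comp B y) n
    comp-*ₛ-≤ N zero _ A B = begin
      (A 0 * B 0) * 1#         ≈⟨ *-identityʳ _ ⟩
      A 0 * B 0                ≈⟨ *-cong (*-identityʳ _) (*-identityʳ _) ⟨
      A 0 * 1# * (B 0 * 1#)    ∎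
    comp-*ₛ-≤ (suc N) (suc n) (s≤s n≤N) A B = begin
      comp (A *ₛ B) y (suc n)
        ≈⟨ comp-suc (A *ₛ B) n ⟩
      (u *ₛ comp (A 0 ·ₛ tail B +ₛ tail A *ₛ B) y) n
        ≈⟨ *ₛ-cong-≤ n (λ _ _ → refl) (λ j j≤n → trans
             (comp-linear-≤ j j ℕₚ.≤-refl (A 0) (tail B) (tail A *ₛ B))
             (+-congˡ (comp-*ₛ-≤ N j (ℕₚ.≤-trans j≤n n≤N) (tail A) B))) ⟩
      (u *ₛ (A 0 ·ₛ comp (tail B) y +ₛ comp (tail A) y *ₛ comp B y)) n
        ≈⟨ *ₛ-distribˡ u (A 0 ·ₛ comp (tail B) y) (comp (tail A) y *ₛ comp B y) n ⟩
      (u *ₛ (A 0 ·ₛ comp (tail B) y)) n + (u *ₛ (comp (tail A) y *ₛ comp B y)) n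
        ≈⟨ +-cong (·ₛ-*ₛ-comm (A 0) u (comp (tail B) y) n) (sym (*ₛ-assoc u (comp (tail A) y) (comp B y) n)) ⟩
      A 0 * (u *ₛ comp (tail B) y) n + ((u *ₛ comp (tail A) y) *ₛ comp B y) n
        ≈⟨ +-cong (*-cong (comp-zero A) (comp-suc B n))
             (*ₛ-cong-≤ n (λ j _ → comp-suc A j) (λ _ _ → refl)) ⟨
      (comp A y *ₛ comp B y) (suc n) ∎

    comp-1ₛ : comp 1ₛ y ≈ₛ 1ₛ
    comp-1ₛ zero    = *-identityʳ 1#
    comp-1ₛ (suc n) = begin
      comp 1ₛ y (suc n)   ≈⟨ comp-suc 1ₛ n ⟩
      (u *ₛ comp 0ₛ y) n  ≈⟨ *ₛ-cong-≤ n (λ _ _ → refl) (λ j _ → comp-0ₛ j) ⟩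
      (u *ₛ 0ₛ) n         ≈⟨ *ₛ-comm u 0ₛ n ⟩
      (0ₛ *ₛ u) n         ≈⟨ *ₛ-zeroˡ u n ⟩
      0#                  ∎
      where
      partial-0ₛ : ∀ N → partial 0ₛ y N ≈ₛ 0ₛ
      partial-0ₛ zero    n = zeroˡ _
      partial-0ₛ (suc N) n = trans (+-cong (partial-0ₛ N n) (zeroˡ _)) (+-identityʳ 0#)
      comp-0ₛ : comp 0ₛ y ≈ₛ 0ₛ
      comp-0ₛ n = partial-0ₛ n n

    comp-^ₛ : ∀ m B → comp (B ^ₛ m) y ≈ₛ comp B y ^ₛ m
    comp-^ₛ zero    B   = comp-1ₛ
    comp-^ₛ (suc m) B n = trans (comp-*ₛ-≤ n n ℕₚ.≤-refl B (B ^ₛ m))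
      (*ₛ-cong {A = comp B y} (λ _ → refl) (comp-^ₛ m B) n)

    comp-1+X : comp 1+X y ≈ₛ 1ₛ +ₛ y
    comp-1+X zero = trans (*-identityʳ 1#) (sym (trans (+-congˡ y₀≈0) (+-identityʳ 1#)))
    comp-1+X (suc n) = begin
      comp 1+X y (suc n)  ≈⟨ comp-suc 1+X n ⟩
      (u *ₛ comp 1ₛ y) n  ≈⟨ *ₛ-cong-≤ n (λ _ _ → refl) (λ j _ → comp-1ₛ j) ⟩
      (u *ₛ 1ₛ) n         ≈⟨ *ₛ-identityʳ u n ⟩
      y (suc n)           ≈⟨ +-identityˡ _ ⟨
      0# + y (suc n)      ∎

  -- The formal derivative and the differential equation of the binomial series.

  D : Series Carrier → Series Carrier
  D A n = suc n ×ₙ A (suc n)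

  D-cong : ∀ {A B} → A ≈ₛ B → D A ≈ₛ D B
  D-cong A≈B n = ×-congʳ (suc n) (A≈B (suc n))

  D-*ₛ : ∀ A B → D (A *ₛ B) ≈ₛ D A *ₛ B +ₛ A *ₛ D B
  D-*ₛ A B zero =
    solve 4 (λ a a′ b b′ → (a :* b′ :+ a′ :* b) :+ con 0 := (a′ :+ con 0) :* b :+ a :* (b′ :+ con 0))
      refl (A 0) (A 1) (B 0) (B 1)
  D-*ₛ A B (suc m) = begin
    m₂ ×ₙ (A 0 * B m₂ + (tail A *ₛ B) (suc m))
      ≈⟨ ×-distrib-+ _ _ m₂ ⟩
    -- One of the m + 2 copies of the tail coefficient splits off; the other m + 1 form the
    -- derivative of `tail A` · B in degree m, to which induction applies.
    m₂ ×ₙ (A 0 * B m₂) + ((tail A *ₛ B) (suc m) + D (tail A *ₛ B) m)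
      ≈⟨ +-cong (sym (×-comm-* m₂ (A 0) (B m₂))) (+-congˡ (D-*ₛ (tail A) B m)) ⟩
    A 0 * D B (suc m) + ((A 1 * B (suc m) + (tail (tail A) *ₛ B) m)
      + ((D (tail A) *ₛ B) m + (tail A *ₛ D B) m))
      ≈⟨ solve 6 (λ a b c d e f → a :+ ((b :* c :+ d) :+ (e :+ f)) := ((b :+ con 0) :* c :+ (d :+ e)) :+ (a :+ f))
           refl (A 0 * D B (suc m)) (A 1) (B (suc m)) ((tail (tail A) *ₛ B) m)
           ((D (tail A) *ₛ B) m) ((tail A *ₛ D B) m) ⟩
    ((A 1 + 0#) * B (suc m) + ((tail (tail A) *ₛ B) m + (D (tail A) *ₛ B) m))
      + (A 0 * D B (suc m) + (tail A *ₛ D B) m)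
      ≈⟨ +-congʳ (+-congˡ (*ₛ-distribʳ B (tail (tail A)) (D (tail A)) m)) ⟨
    (D A *ₛ B) (suc m) + (A *ₛ D B) (suc m) ∎
    where m₂ = 2 ℕ.+ m

  D-^ₛ : ∀ m A → D (A ^ₛ suc m) ≈ₛ suc m ×ₛ ((A ^ₛ m) *ₛ D A)
  D-^ₛ zero A n = begin
    D (A *ₛ 1ₛ) n             ≈⟨ D-cong (*ₛ-identityʳ A) n ⟩
    D A n                     ≈⟨ *ₛ-identityˡ (D A) n ⟨
    (1ₛ *ₛ D A) n             ≈⟨ +-identityʳ _ ⟨
    (1ₛ *ₛ D A) n + 0#        ∎
  D-^ₛ (suc m) A n = begin
    D (A *ₛ P) n                                   ≈⟨ D-*ₛ A P n ⟩
    (D A *ₛ P) n + (A *ₛ D P) n                    ≈⟨ +-cong (*ₛ-comm (D A) P n) (*ₛ-cong {A = A} 𝕊.refl (D-^ₛ m A) n) ⟩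
    (P *ₛ D A) n + (A *ₛ (suc m ×ₛ (Q *ₛ D A))) n  ≈⟨ +-congˡ (×ₛ-comm-* (suc m) A (Q *ₛ D A) n) ⟩
    (P *ₛ D A) n + (suc m ×ₛ (A *ₛ (Q *ₛ D A))) n  ≈⟨ +-congˡ (×ₛ-congʳ (suc m) (*ₛ-assoc A Q (D A)) n) ⟨
    (suc (suc m) ×ₛ (P *ₛ D A)) n                  ∎
    where
    P = A ^ₛ suc m
    Q = A ^ₛ m

  module _ (torsionFree : ∀ n {x} → suc n ×ₙ x ≈ 0# → x ≈ 0#) where

    private
      cancelˡ : ∀ {x y z} → x + y ≈ x + z → y ≈ z
      cancelˡ = GroupProperties.∙-cancelˡ +-group _ _ _

    -- Comparing coefficients gives (n + 1) W(n+1) = (1 - n) W(n). The factor on the right vanishes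
    -- at n = 1, so from X² on every coefficient is torsion and hence zero.
    ode-unique : ∀ {W} → W 0 ≈ 1# → 1+X *ₛ D W ≈ₛ W → W ≈ₛ 1+X
    ode-unique {W} W₀≈1 ode = λ where
        zero          → W₀≈1
        (suc zero)    → W₁≈1
        (suc (suc n)) → higher n
      where
      W₁≈1 : W 1 ≈ 1#
      W₁≈1 = trans (sym (trans (*-identityˡ _) (+-identityʳ _))) (trans (ode 0) W₀≈1)
      step : ∀ n → D W n + D W (suc n) ≈ W (suc n)
      step n = begin
        D W n + D W (suc n)                ≈⟨ +-comm _ _ ⟩
        D W (suc n) + D W n                ≈⟨ +-cong (*-identityˡ _) (*ₛ-identityˡ (D W) n) ⟨
        1# * D W (suc n) + (1ₛ *ₛ D W) n   ≈⟨ ode (suc n) ⟩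
        W (suc n)                          ∎
      higher : ∀ n → W (2 ℕ.+ n) ≈ 0#
      higher zero = torsionFree 1 (cancelˡ (begin
        W 1 + D W 1        ≈⟨ +-congʳ (+-identityʳ (W 1)) ⟨
        D W 0 + D W 1      ≈⟨ step 0 ⟩
        W 1                ≈⟨ +-identityʳ (W 1) ⟨
        W 1 + 0#           ∎))
      higher (suc n) = torsionFree (2 ℕ.+ n) (begin
        D W (2 ℕ.+ n)                    ≈⟨ +-identityˡ _ ⟨
        0# + D W (2 ℕ.+ n)               ≈⟨ +-congʳ D≈0 ⟨
        D W (suc n) + D W (2 ℕ.+ n)      ≈⟨ step (suc n) ⟩
        W (2 ℕ.+ n)                      ≈⟨ higher n ⟩
        0#                               ∎)
        where
        D≈0 : D W (suc n) ≈ 0#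
        D≈0 = trans (×-congʳ (2 ℕ.+ n) (higher n)) (×-zeroʳ (2 ℕ.+ n))

    -- The recurrence says that b is the coefficient sequence of (1+X)^α.
    binomial-root : ∀ m {α} → suc m ×ₙ α ≈ 1# → ∀ {b} → b 0 ≈ 1# →
                    (∀ n → suc n ×ₙ b (suc n) + n ×ₙ b n ≈ α * b n) →
                    b ^ₛ suc m ≈ₛ 1+X
    binomial-root m {α} mα≈1 {b} b₀≈1 rec = ode-unique (constant (suc m)) λ n → begin
      (1+X *ₛ D (b ^ₛ suc m)) n
        ≈⟨ *ₛ-cong {A = 1+X} 𝕊.refl (D-^ₛ m b) n ⟩
      (1+X *ₛ (suc m ×ₛ (P *ₛ D b))) n
        ≈⟨ ×ₛ-comm-* (suc m) 1+X (P *ₛ D b) n ⟩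
      (suc m ×ₛ (1+X *ₛ (P *ₛ D b))) n
        ≡⟨ ×ₛ-coeff (suc m) _ n ⟩
      suc m ×ₙ (1+X *ₛ (P *ₛ D b)) n
        ≈⟨ ×-congʳ (suc m) (trans (sym (*ₛ-assoc 1+X P (D b) n)) (trans
             (*ₛ-cong {C = D b} (*ₛ-comm 1+X P) 𝕊.refl n) (*ₛ-assoc P 1+X (D b) n))) ⟩
      suc m ×ₙ (P *ₛ (1+X *ₛ D b)) n
        ≈⟨ ×-congʳ (suc m) (*ₛ-cong {A = P} 𝕊.refl ode n) ⟩
      suc m ×ₙ (P *ₛ (α ·ₛ b)) n
        ≈⟨ ×-congʳ (suc m) (trans (·ₛ-*ₛ-comm α P b n) (*-congˡ (*ₛ-comm P b n))) ⟩
      suc m ×ₙ (α * (b ^ₛ suc m) n)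
        ≈⟨ ×-assoc-* (suc m) α _ ⟨
      (suc m ×ₙ α) * (b ^ₛ suc m) n
        ≈⟨ *-congʳ mα≈1 ⟩
      1# * (b ^ₛ suc m) n
        ≈⟨ *-identityˡ _ ⟩
      (b ^ₛ suc m) n ∎
      where
      P = b ^ₛ m
      constant : ∀ k → (b ^ₛ k) 0 ≈ 1#
      constant zero    = refl
      constant (suc k) = trans (*-cong b₀≈1 (constant k)) (*-identityˡ 1#)
      ode : 1+X *ₛ D b ≈ₛ α ·ₛ b
      ode zero = trans (*-identityˡ _) (trans (sym (+-identityʳ _)) (rec 0))
      ode (suc n) =
        trans (+-cong (*-identityˡ _) (*ₛ-identityˡ (D b) n)) (rec (suc n))

    comp-binomial-root : ∀ m {α} → suc m ×ₙ α ≈ 1# → ∀ {b} → b 0 ≈ 1# →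
                         (∀ n → suc n ×ₙ b (suc n) + n ×ₙ b n ≈ α * b n) →
                         ∀ {y} → y 0 ≈ 0# → comp b y ^ₛ suc m ≈ₛ 1ₛ +ₛ y
    comp-binomial-root m mα≈1 {b} b₀≈1 rec {y} y₀≈0 n = begin
      (comp b y ^ₛ suc m) n   ≈⟨ comp-^ₛ y₀≈0 (suc m) b n ⟨
      comp (b ^ₛ suc m) y n   ≈⟨ comp-cong y₀≈0 (binomial-root m mα≈1 b₀≈1 rec) n ⟩
      comp 1+X y n            ≈⟨ comp-1+X y₀≈0 n ⟩
      (1ₛ +ₛ y) n             ∎

  -- Binomial coefficients with arbitrary upper entry.

  module _ (inverse : ∀ n → ∃ λ e → suc n ×ₙ e ≈ 1#) where

    ×-cancel : ∀ n .{{_ : ℕ.NonZero n}} {x y} → n ×ₙ x ≈ n ×ₙ y → x ≈ y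
    ×-cancel (suc n) {x} {y} nx≈ny = begin
      x                                 ≈⟨ *-identityʳ x ⟨
      x * 1#                            ≈⟨ *-congˡ (proj₂ (inverse n)) ⟨
      x * (suc n ×ₙ e)                  ≈⟨ swap x ⟩
      (suc n ×ₙ x) * e                  ≈⟨ *-congʳ nx≈ny ⟩
      (suc n ×ₙ y) * e                  ≈⟨ swap y ⟨
      y * (suc n ×ₙ e)                  ≈⟨ *-congˡ (proj₂ (inverse n)) ⟩
      y * 1#                            ≈⟨ *-identityʳ y ⟩
      y                                 ∎
      where
      e = proj₁ (inverse n)
      swap : ∀ z → z * (suc n ×ₙ e) ≈ (suc n ×ₙ z) * e
      swap z = trans (×-comm-* (suc n) z e) (sym (×-assoc-* (suc n) z e))

    module _ {α : Carrier} {fall b : ℕ → Carrier} (fall-zero : fall 0 ≈ 1#)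
             (fall-suc : ∀ n → fall (suc n) ≈ fall n * (α + - (n ×ₙ 1#)))
             (n!b≈fall : ∀ n → (n !) ×ₙ b n ≈ fall n) where

      binomial-zero : b 0 ≈ 1#
      binomial-zero = trans (sym (×-homo-1 (b 0))) (trans (n!b≈fall 0) fall-zero)

      -- Multiplication by n! turns everything into multiples of `fall n`, where the claim reads (α
      -- - n) + n = α; then n! is cancelled. In terms of series this is (1+X) b′ = α b.
      binomial-recurrence : ∀ n → suc n ×ₙ b (suc n) + n ×ₙ b n ≈ α * b n
      binomial-recurrence n = ×-cancel (n !) {{n ℕₚ.!≢0}} (begin
        (n !) ×ₙ (suc n ×ₙ b (suc n) + n ×ₙ b n)
          ≈⟨ ×-distrib-+ _ _ (n !) ⟩
        (n !) ×ₙ (suc n ×ₙ b (suc n)) + (n !) ×ₙ (n ×ₙ b n)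
          ≈⟨ +-cong (×-assocˡ (b (suc n)) (n !) (suc n)) (×-assocˡ (b n) (n !) n) ⟩
        (n ! ℕ.* suc n) ×ₙ b (suc n) + (n ! ℕ.* n) ×ₙ b n
          ≈⟨ +-cong (×-congˡ (ℕₚ.*-comm (n !) (suc n))) (×-congˡ (ℕₚ.*-comm (n !) n)) ⟩
        ((suc n) !) ×ₙ b (suc n) + (n ℕ.* n !) ×ₙ b n
          ≈⟨ +-cong (trans (n!b≈fall (suc n)) (fall-suc n)) (sym (×-assocˡ (b n) n (n !))) ⟩
        fall n * (α + - (n ×ₙ 1#)) + n ×ₙ ((n !) ×ₙ b n)
          ≈⟨ +-congˡ (trans (×-congʳ n (n!b≈fall n))
               (trans (×-congʳ n (sym (*-identityʳ _))) (sym (×-comm-* n (fall n) 1#)))) ⟩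
        fall n * (α + - (n ×ₙ 1#)) + fall n * (n ×ₙ 1#)
          ≈⟨ distribˡ (fall n) _ _ ⟨
        fall n * (α + - (n ×ₙ 1#) + n ×ₙ 1#)
          ≈⟨ *-congˡ (trans (+-assoc _ _ _) (trans (+-congˡ (-‿inverseˡ _)) (+-identityʳ α))) ⟩
        fall n * α
          ≈⟨ *-comm _ _ ⟩
        α * fall n
          ≈⟨ *-congˡ (n!b≈fall n) ⟨
        α * ((n !) ×ₙ b n)
          ≈⟨ ×-comm-* (n !) α (b n) ⟩
        (n !) ×ₙ (α * b n) ∎)

-- Integrality and congruences of power series.

module FilteredSeries {ℓ f : Level} (K : CommutativeRing 0ℓ ℓ) (p : ℕ) (𝓕 : Filtration K p f) where

  open CommutativeRing K
  open Filtration 𝓕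
  open Filtered K p 𝓕
  open PowerSeries K
  open Mult semiring renaming (_×_ to _×ₙ_)
  open Exp semiring using (_^_)
  open SetoidReasoning setoid
  private module 𝕊 = CommutativeRing seriesRing
  open Exp 𝕊.semiring using () renaming (_^_ to _^ₛ_; ^-congˡ to ^ₛ-congˡ)
  open CExp 𝕊.commutativeSemiring using () renaming (^-distrib-* to ^ₛ-distrib-*ₛ)
  open Mult 𝕊.semiring using () renaming (_×_ to _×ₛ_)

  F-cancelʳ : ∀ k {x y} → F k (x + y) → F k y → F k x
  F-cancelʳ k {x} {y} x+y∈ y∈ = F-resp k
    (trans (+-assoc x y (- y)) (trans (+-congˡ (-‿inverseʳ y)) (+-identityʳ x)))
    (F-+ k x+y∈ (F-neg k y∈))

  F-*ₛ : ∀ k l n {A B} → (∀ j → j ≤ n → F k (A j)) → (∀ j → j ≤ n → F l (B j)) →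
         F (k ℕ.+ l) ((A *ₛ B) n)
  F-*ₛ k l zero    A∈ B∈ = F-* k l (A∈ 0 z≤n) (B∈ 0 z≤n)
  F-*ₛ k l (suc n) A∈ B∈ = F-+ (k ℕ.+ l) (F-* k l (A∈ 0 z≤n) (B∈ (suc n) ℕₚ.≤-refl))
    (F-*ₛ k l n (λ j j≤n → A∈ (suc j) (s≤s j≤n)) (λ j j≤n → B∈ j (ℕₚ.m≤n⇒m≤1+n j≤n)))

  -- Truncation makes the results on filtered rings available to a series of which only the
  -- coefficients below n are under control. This is the situation of Δ in the induction of
  -- `^ₛp-injective`.
  below : ℕ → Filtration seriesRing p f
  below n = record
    { F      = λ k A → ∀ j → j < n → F k (A j)
    ; F-resp = λ k A≈B A∈ j j<n → F-resp k (A≈B j) (A∈ j j<n)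
    ; F-0#   = λ k j _ → F-0# k
    ; F-1#   = λ { zero _ → F-1# ; (suc _) _ → F-0# 0 }
    ; F-+    = λ k A∈ B∈ j j<n → F-+ k (A∈ j j<n) (B∈ j j<n)
    ; F-neg  = λ k A∈ j j<n → F-neg k (A∈ j j<n)
    ; F-*    = λ k l A∈ B∈ j j<n → F-*ₛ k l j
        (λ i i≤j → A∈ i (ℕₚ.≤-<-trans i≤j j<n)) (λ i i≤j → B∈ i (ℕₚ.≤-<-trans i≤j j<n))
    ; F-pred = λ k A∈ j j<n → F-pred k (A∈ j j<n)
    ; F-p×   = λ k {A} A∈ j j<n →
        ≡.subst (F (suc k)) (≡.sym (×ₛ-coeff p A j)) (F-p× k (A∈ j j<n))
    }

  private module Below n = Filtered seriesRing p (below n)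

  infix 4 _≡ₛ[_]_

  _≡ₛ[_]_ : Series Carrier → ℕ → Series Carrier → Set _
  A ≡ₛ[ k ] B = ∀ n → A n ≡[ k ] B n

  toBelow : ∀ k {A B} → A ≡ₛ[ k ] B → ∀ n → Below._≡[_]_ n A k B
  toBelow k A≡B n = Below.differ-by (λ j → diff (A≡B j)) (λ j _ → diff∈ (A≡B j)) (λ j → equation (A≡B j))

  fromBelow : ∀ k {A B} n → Below._≡[_]_ (suc n) A k B → A n ≡[ k ] B n
  fromBelow k n (Below.differ-by d d∈ eq) = differ-by (d n) (d∈ n ℕₚ.≤-refl) (eq n)

  Integral : Series Carrier → Set f
  Integral A = ∀ n → F 0 (A n)

  Integral-^ₛ : ∀ m {A} → Integral A → Integral (A ^ₛ m)
  Integral-^ₛ m A∈ n = Below.F-^ (suc n) m (λ j _ → A∈ j) n ℕₚ.≤-refl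

  ^ₛ-constant : ∀ m {A} → A 0 ≈ 1# → (A ^ₛ m) 0 ≈ 1#
  ^ₛ-constant zero    A₀≈1 = refl
  ^ₛ-constant (suc m) A₀≈1 = trans (*-cong A₀≈1 (^ₛ-constant m A₀≈1)) (*-identityˡ 1#)

  ^ₛp^-cong : ∀ r k {A B} → Integral B → A ≡ₛ[ suc k ] B →
              (A ^ₛ (p ℕ.^ r)) ≡ₛ[ suc (r ℕ.+ k) ] (B ^ₛ (p ℕ.^ r))
  ^ₛp^-cong r k B∈ A≡B n = fromBelow (suc (r ℕ.+ k)) n
    (Below.^p^-cong (suc n) r k (λ j _ → B∈ j) (toBelow (suc k) A≡B (suc n)))

  X : Series Carrier
  X zero    = 0#
  X (suc n) = 1ₛ n

  X*ₛ-suc : ∀ A n → (X *ₛ A) (suc n) ≈ A n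
  X*ₛ-suc A n = trans (tail-*ₛ X A refl n) (*ₛ-identityˡ A n)

  split : ∀ A → A ≈ₛ A 0 ·ₛ 1ₛ +ₛ X *ₛ tail A
  split A zero    = sym (trans (+-cong (*-identityʳ _) (zeroˡ _)) (+-identityʳ _))
  split A (suc n) = sym (trans (+-cong (zeroʳ _) (X*ₛ-suc (tail A) n)) (+-identityˡ _))

  ·1ₛ-^ₛ : ∀ m a → (a ·ₛ 1ₛ) ^ₛ m ≈ₛ (a ^ m) ·ₛ 1ₛ
  ·1ₛ-^ₛ zero    a n = sym (*-identityˡ _)
  ·1ₛ-^ₛ (suc m) a n = begin
    ((a ·ₛ 1ₛ) *ₛ ((a ·ₛ 1ₛ) ^ₛ m)) n  ≈⟨ ·ₛ-*ₛ-assoc a 1ₛ _ n ⟩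
    a * (1ₛ *ₛ ((a ·ₛ 1ₛ) ^ₛ m)) n     ≈⟨ *-congˡ (*ₛ-identityˡ _ n) ⟩
    a * ((a ·ₛ 1ₛ) ^ₛ m) n             ≈⟨ *-congˡ (·1ₛ-^ₛ m a n) ⟩
    a * (a ^ m * 1ₛ n)                 ≈⟨ *-assoc _ _ _ ⟨
    a ^ suc m * 1ₛ n                   ∎

  X^*ₛ : ∀ m A n → ((X ^ₛ m) *ₛ A) (m ℕ.+ n) ≈ A n
  X^*ₛ zero    A n = *ₛ-identityˡ A n
  X^*ₛ (suc m) A n = begin
    ((X *ₛ (X ^ₛ m)) *ₛ A) (suc m ℕ.+ n)  ≈⟨ *ₛ-assoc X (X ^ₛ m) A (suc m ℕ.+ n) ⟩
    (X *ₛ ((X ^ₛ m) *ₛ A)) (suc m ℕ.+ n)  ≈⟨ X*ₛ-suc ((X ^ₛ m) *ₛ A) (m ℕ.+ n) ⟩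
    ((X ^ₛ m) *ₛ A) (m ℕ.+ n)             ≈⟨ X^*ₛ m A n ⟩
    A n                                   ∎

  module _ (pr : Prime p) where

    private instance
      p≢0 : ℕ.NonZero p
      p≢0 = prime⇒nonZero pr

    q>0 : ∀ r → 0 < p ℕ.^ r
    q>0 r = ℕₚ.m^n>0 p r

    -- A = A(0) + X A⁺ gives A^q ≡ A(0)^q + X^q (A⁺)^q mod p.
    frobenius-coeff : (∀ {x} → F 0 x → x ^ p ≡[ 1 ] x) → ∀ r n {A} → Integral A →
                      (A ^ₛ (p ℕ.^ r)) (n ℕ.* p ℕ.^ r) ≡[ 1 ] A n
    frobenius-coeff fermat r n {A} A∈ =
      ≡[]-trans 1 (≡[]-reflexive 1 (^ₛ-congˡ q (split A) (n ℕ.* q)))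
        (≡[]-trans 1 (fromBelow 1 (n ℕ.* q) (Below.freshman^ (suc (n ℕ.* q)) pr r const∈ X*∈))
          (rest n))
      where
      q = p ℕ.^ r
      a = A 0
      const∈ : ∀ j → j < suc (n ℕ.* q) → F 0 (a * 1ₛ j)
      const∈ j _ = F-* 0 0 (A∈ 0) (Filtration.F-1# (below (suc j)) j ℕₚ.≤-refl)
      X*∈ : ∀ j → j < suc (n ℕ.* q) → F 0 ((X *ₛ tail A) j)
      X*∈ zero    _ = F-resp 0 (sym (zeroˡ _)) (F-0# 0)
      X*∈ (suc j) _ = F-resp 0 (sym (X*ₛ-suc (tail A) j)) (A∈ (suc j))
      1ₛ-pos : ∀ {m} → 0 < m → 1ₛ m ≈ 0#
      1ₛ-pos {suc m} _ = refl
      X^q*-zero : ∀ m {B} → 0 < m → ((X ^ₛ m) *ₛ B) 0 ≈ 0#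
      X^q*-zero (suc m) _ = trans (*-congʳ (zeroˡ _)) (zeroˡ _)
      -- In degree 0 only a^q survives and Fermat reduces it to a. In degree (n + 1) q the constant
      -- series contributes nothing and X^q shifts the index down by q, leaving the same claim for
      -- `tail A` at n.
      rest : ∀ n → ((a ·ₛ 1ₛ) ^ₛ q) (n ℕ.* q) + ((X *ₛ tail A) ^ₛ q) (n ℕ.* q) ≡[ 1 ] A n
      rest zero = ≡[]-trans 1 (≡[]-reflexive 1 (begin
        ((a ·ₛ 1ₛ) ^ₛ q) 0 + ((X *ₛ tail A) ^ₛ q) 0
          ≈⟨ +-cong (·1ₛ-^ₛ q a 0) (^ₛ-distrib-*ₛ X (tail A) q 0) ⟩
        a ^ q * 1# + ((X ^ₛ q) *ₛ (tail A ^ₛ q)) 0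
          ≈⟨ +-cong (*-identityʳ _) (X^q*-zero q {tail A ^ₛ q} (q>0 r)) ⟩
        a ^ q + 0#
          ≈⟨ +-identityʳ _ ⟩
        a ^ q ∎)) (fermat^ fermat r (A∈ 0))
      rest (suc n) = ≡[]-trans 1 (≡[]-reflexive 1 (begin
        ((a ·ₛ 1ₛ) ^ₛ q) (q ℕ.+ n ℕ.* q) + ((X *ₛ tail A) ^ₛ q) (q ℕ.+ n ℕ.* q)
          ≈⟨ +-cong (·1ₛ-^ₛ q a (q ℕ.+ n ℕ.* q)) (^ₛ-distrib-*ₛ X (tail A) q (q ℕ.+ n ℕ.* q)) ⟩
        a ^ q * 1ₛ (q ℕ.+ n ℕ.* q) + ((X ^ₛ q) *ₛ (tail A ^ₛ q)) (q ℕ.+ n ℕ.* q)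
          ≈⟨ +-cong (trans (*-congˡ (1ₛ-pos (ℕₚ.<-≤-trans (q>0 r) (ℕₚ.m≤m+n q _)))) (zeroʳ _))
               (X^*ₛ q (tail A ^ₛ q) (n ℕ.* q)) ⟩
        0# + (tail A ^ₛ q) (n ℕ.* q)
          ≈⟨ +-identityˡ _ ⟩
        (tail A ^ₛ q) (n ℕ.* q) ∎)) (frobenius-coeff fermat r n (A∈ ∘ suc))

    integral⇒cong : (∀ {x} → F 0 x → x ^ p ≡[ 1 ] x) → ∀ r {G f} → Integral G →
                    G ^ₛ (p ℕ.^ r) ≈ₛ f →
                    f ≡ₛ[ suc r ] ((λ n → f (n ℕ.* p ℕ.^ r)) ^ₛ (p ℕ.^ r))
    integral⇒cong fermat r {G} {f} G∈ G^q≈f n =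
      ≡[]-trans (suc r) (≡[]-reflexive (suc r) (sym (G^q≈f n)))
        (≡[]-sym (suc r) (≡.subst (λ k → (h ^ₛ q) n ≡[ suc k ] (G ^ₛ q) n) (ℕₚ.+-identityʳ r)
          (^ₛp^-cong r 0 G∈ h≡G n)))
      where
      q = p ℕ.^ r
      h = λ n → f (n ℕ.* q)
      h≡G : h ≡ₛ[ 1 ] G
      h≡G n = ≡[]-trans 1 (≡[]-reflexive 1 (sym (G^q≈f (n ℕ.* q)))) (frobenius-coeff fermat r n G∈)

    module _ (divide : ∀ k {x} → F (suc k) (p ×ₙ x) → F k x) where

      -- With G = H + Δ, the coefficient of Xⁿ in G^p − H^p is p Δ(n) plus terms
      -- that only involve Δ(j) for j < n.
      ^ₛp-injective : ∀ k {G H} → G 0 ≈ 1# → H 0 ≈ 1# → Integral H →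
                      (G ^ₛ p) ≡ₛ[ suc (suc k) ] (H ^ₛ p) → G ≡ₛ[ suc k ] H
      ^ₛp-injective k {G} {H} G₀≈1 H₀≈1 H∈ G^p≡H^p i = differ-by (Δ i) (Δ∈ (suc i) i ℕₚ.≤-refl) (G≈H+Δ i)
        where
        k₁ = suc k
        k₂ = suc (suc k)
        Δ : Series Carrier
        Δ = G +ₛ -ₛ H
        G≈H+Δ : G ≈ₛ H +ₛ Δ
        G≈H+Δ n = begin
          G n                   ≈⟨ +-identityʳ _ ⟨
          G n + 0#              ≈⟨ +-congˡ (-‿inverseˡ (H n)) ⟨
          G n + (- H n + H n)   ≈⟨ +-assoc _ _ _ ⟨
          Δ n + H n             ≈⟨ +-comm _ _ ⟩
          H n + Δ n             ∎
        Δ₀≈0 : Δ 0 ≈ 0#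
        Δ₀≈0 = trans (+-congʳ (trans G₀≈1 (sym H₀≈1))) (-‿inverseʳ (H 0))

        -- With both constant terms zero, the coefficient at m + 1 pairs only indices from 1 to m,
        -- so the hypotheses below m + 1 suffice. The product then has level 2k + 2, which is at
        -- least k + 2.
        quadratic∈ : ∀ m {A B} → A 0 ≈ 0# → B 0 ≈ 0# → (∀ j → j < suc m → F k₁ (A j)) →
                     (∀ j → j < suc m → F k₁ (B j)) → F k₂ ((A *ₛ B) (suc m))
        quadratic∈ zero {A} {B} A₀≈0 B₀≈0 A∈ B∈ =
          F-resp k₂ (sym (trans (tail-*ₛ A B A₀≈0 0) (trans (*-congˡ B₀≈0) (zeroʳ _)))) (F-0# k₂)
        quadratic∈ (suc m) {A} {B} A₀≈0 B₀≈0 A∈ B∈ = F-resp k₂ (sym (begin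
          (A *ₛ B) (suc (suc m))      ≈⟨ tail-*ₛ A B A₀≈0 (suc m) ⟩
          (tail A *ₛ B) (suc m)       ≈⟨ *ₛ-comm (tail A) B (suc m) ⟩
          (B *ₛ tail A) (suc m)       ≈⟨ tail-*ₛ B (tail A) B₀≈0 m ⟩
          (tail B *ₛ tail A) m        ∎))
          (F-drop k k₂ (F-cast (≡.sym (ℕₚ.+-suc k k₁))
            (F-*ₛ k₁ k₁ m (λ j j≤m → B∈ (suc j) (s≤s (s≤s j≤m))) (λ j j≤m → A∈ (suc j) (s≤s (s≤s j≤m))))))

        step : ∀ m → (∀ j → j < suc m → F k₁ (Δ j)) → F k₁ (Δ (suc m))
        step m Δ∈ = F-cancelʳ k₁ (F-resp k₁ (+-congʳ head≈) (divide k₁ p×∈)) rest∈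
          where
          n = suc m
          Δ∈₀ : ∀ j → j < n → F 0 (Δ j)
          Δ∈₀ j j<n = F-drop k₁ 0 (F-cast (≡.sym (ℕₚ.+-identityʳ k₁)) (Δ∈ j j<n))
          -- The expansion is an equation in every degree, but T is known to be integral only below
          -- n. This is enough because Δ has no constant term, so T(n) never meets a nonzero factor.
          expansion = Below.taylor n p (λ j _ → H∈ j) Δ∈₀
          T = proj₁ expansion
          T∈ = proj₁ (proj₂ expansion)
          P = H ^ₛ pred p
          ΔT∈ : ∀ j → j < n → F k₁ ((Δ *ₛ T) j)
          ΔT∈ j j<n = F-cast (ℕₚ.+-identityʳ k₁) (F-*ₛ k₁ 0 j
            (λ i i≤j → Δ∈ i (ℕₚ.≤-<-trans i≤j j<n)) (λ i i≤j → T∈ i (ℕₚ.≤-<-trans i≤j j<n)))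
          Δ²T∈ : F k₂ (((Δ *ₛ Δ) *ₛ T) n)
          Δ²T∈ = F-resp k₂ (sym (*ₛ-assoc Δ Δ T n))
            (quadratic∈ m Δ₀≈0 (trans (*-congʳ Δ₀≈0) (zeroˡ _)) Δ∈ ΔT∈)
          d = diff (G^p≡H^p n)
          linear+quadratic≈d : p ×ₙ (P *ₛ Δ) n + ((Δ *ₛ Δ) *ₛ T) n ≈ d
          linear+quadratic≈d = GroupProperties.∙-cancelˡ +-group ((H ^ₛ p) n) _ _ (begin
            (H ^ₛ p) n + (p ×ₙ (P *ₛ Δ) n + ((Δ *ₛ Δ) *ₛ T) n)
              ≡⟨ ≡.cong (λ z → (H ^ₛ p) n + (z + ((Δ *ₛ Δ) *ₛ T) n)) (×ₛ-coeff p (P *ₛ Δ) n) ⟨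
            (H ^ₛ p) n + ((p ×ₛ (P *ₛ Δ)) n + ((Δ *ₛ Δ) *ₛ T) n)
              ≈⟨ proj₂ (proj₂ expansion) n ⟨
            ((H +ₛ Δ) ^ₛ p) n
              ≈⟨ ^ₛ-congˡ p G≈H+Δ n ⟨
            (G ^ₛ p) n
              ≈⟨ equation (G^p≡H^p n) ⟩
            (H ^ₛ p) n + d ∎)
          p×∈ : F k₂ (p ×ₙ (P *ₛ Δ) n)
          p×∈ = F-cancelʳ k₂
            (F-resp k₂ (sym linear+quadratic≈d) (diff∈ (G^p≡H^p n))) Δ²T∈
          -- After division by p the wanted Δ(n) appears with coefficient P(0), which is 1 because
          -- H(0) = 1.
          head≈ : P 0 * Δ n ≈ Δ n
          head≈ = trans (*-congʳ (^ₛ-constant (pred p) H₀≈1)) (*-identityˡ _)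
          rest∈ : F k₁ ((tail P *ₛ Δ) m)
          rest∈ = F-*ₛ 0 k₁ m (λ j _ → Integral-^ₛ (pred p) H∈ (suc j)) (λ j j≤m → Δ∈ j (s≤s j≤m))

        Δ∈ : ∀ n j → j < n → F k₁ (Δ j)
        Δ∈ (suc n) j (s≤s j≤n) with ℕₚ.m≤n⇒m<n∨m≡n j≤n
        ... | inj₁ j<n = Δ∈ n j j<n
        Δ∈ (suc zero)    _ _ | inj₂ ≡.refl = F-resp k₁ (sym Δ₀≈0) (F-0# k₁)
        Δ∈ (suc (suc m)) _ _ | inj₂ ≡.refl = step m (Δ∈ (suc m))

      ^ₛp^-injective : ∀ r k {G H} → G 0 ≈ 1# → H 0 ≈ 1# → Integral H →
                       (G ^ₛ (p ℕ.^ r)) ≡ₛ[ suc (r ℕ.+ k) ] (H ^ₛ (p ℕ.^ r)) → G ≡ₛ[ suc k ] H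
      ^ₛp^-injective zero k {G} {H} G₀≈1 H₀≈1 H∈ G≡H n =
        ≡[]-trans (suc k) (≡[]-reflexive (suc k) (sym (𝕊.*-identityʳ G n)))
          (≡[]-trans (suc k) (G≡H n) (≡[]-reflexive (suc k) (𝕊.*-identityʳ H n)))
      ^ₛp^-injective (suc r) k {G} {H} G₀≈1 H₀≈1 H∈ G^≡H^ =
        ^ₛp^-injective r k G₀≈1 H₀≈1 H∈
          (^ₛp-injective (r ℕ.+ k) (^ₛ-constant (p ℕ.^ r) G₀≈1) (^ₛ-constant (p ℕ.^ r) H₀≈1)
            (Integral-^ₛ (p ℕ.^ r) H∈) λ n →
            -- `^p^-suc` is a pure ring identity, so the truncation bound 0 is an arbitrary choice.
            ≡[]-trans _ (≡[]-reflexive _ (sym (Below.^p^-suc 0 r G n)))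
              (≡[]-trans _ (G^≡H^ n) (≡[]-reflexive _ (Below.^p^-suc 0 r H n))))

      cong⇒integral : ∀ r {G f} → G 0 ≈ 1# → Integral f → f 0 ≈ 1# → G ^ₛ (p ℕ.^ r) ≈ₛ f →
                      f ≡ₛ[ suc r ] ((λ n → f (n ℕ.* p ℕ.^ r)) ^ₛ (p ℕ.^ r)) → Integral G
      cong⇒integral r {G} {f} G₀≈1 f∈ f₀≈1 G^q≈f f≡h^q n =
        F-≡[] 0 (≡[]-pred 0 (^ₛp^-injective r 0 {G} {h} G₀≈1 f₀≈1 h∈ G^q≡h^q n)) (h∈ n)
        where
        h = λ n → f (n ℕ.* p ℕ.^ r)
        h∈ : Integral h
        h∈ n = f∈ (n ℕ.* p ℕ.^ r)
        G^q≡h^q : (G ^ₛ (p ℕ.^ r)) ≡ₛ[ suc (r ℕ.+ 0) ] (h ^ₛ (p ℕ.^ r))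
        G^q≡h^q = ≡.subst (λ k → (G ^ₛ (p ℕ.^ r)) ≡ₛ[ suc k ] (h ^ₛ (p ℕ.^ r))) (≡.sym (ℕₚ.+-identityʳ r))
          λ n → ≡[]-trans (suc r) (≡[]-reflexive (suc r) (G^q≈f n)) (f≡h^q n)

  -- The criterion over an abstract coefficient ring. Fermat, division by p and inverses of positive
  -- integers are all that it takes from ℚ_p; α, `fall` and b enter through their defining
  -- equations, so any encoding that satisfies these can be inserted.
  root-integrality : Prime p → (∀ {x} → F 0 x → x ^ p ≡[ 1 ] x) → (∀ k {x} → F (suc k) (p ×ₙ x) → F k x) →
    (∀ n → ∃ λ e → suc n ×ₙ e ≈ 1#) →
    ∀ r {α} → (p ℕ.^ r) ×ₙ α ≈ 1# → ∀ {fall b} → fall 0 ≈ 1# →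
    (∀ n → fall (suc n) ≈ fall n * (α + - (n ×ₙ 1#))) → (∀ n → (n !) ×ₙ b n ≈ fall n) →
    ∀ {y f} → y 0 ≈ 0# → f ≈ₛ 1ₛ +ₛ y → Integral f →
    Integral (comp b y) ⇔ (f ≡ₛ[ suc r ] ((λ n → f (n ℕ.* p ℕ.^ r)) ^ₛ (p ℕ.^ r)))
  root-integrality pr fermat divide inverse r {α} qα≈1 {fall} {b} fall-zero fall-suc n!b≈fall {y} {f} y₀≈0 f≈1+y f∈ =
    mk⇔ (λ G∈ → integral⇒cong pr fermat r G∈ G^q≈f)
        (cong⇒integral pr divide r (trans (comp-zero {y} y₀≈0 b) b₀≈1) f∈
          (trans (f≈1+y 0) (trans (+-congˡ y₀≈0) (+-identityʳ 1#))) G^q≈f)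
    where
    b₀≈1 = binomial-zero inverse {α} {fall} {b} fall-zero fall-suc n!b≈fall
    root : ∀ q → 0 < q → q ×ₙ α ≈ 1# → comp b y ^ₛ q ≈ₛ 1ₛ +ₛ y
    root (suc m) _ qα≈1 = comp-binomial-root
      (λ n nx≈0 → ×-cancel inverse (suc n) (trans nx≈0 (sym (×-zeroʳ (suc n)))))
      m qα≈1 b₀≈1 (binomial-recurrence inverse fall-zero fall-suc n!b≈fall) y₀≈0
    G^q≈f : comp b y ^ₛ (p ℕ.^ r) ≈ₛ f
    G^q≈f n = trans (root (p ℕ.^ r) (q>0 pr r) qα≈1 n) (sym (f≈1+y n))

-- Inverting p in a commutative ring.

-- The powers of p form an abstract family instead of iterated products, so that `s k` can be the
-- constant sequence p^k of the encoding. `s-cancel` says that p^k is not a zero divisor, which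
-- makes equality of fractions transitive.
record PowersOf {c ℓ : Level} (R : CommutativeRing c ℓ) (p : ℕ) : Set (c ⊔ ℓ) where
  open CommutativeRing R
  open Mult semiring using () renaming (_×_ to _×ₙ_)
  field
    s        : ℕ → Carrier
    s-0      : s 0 ≈ 1#
    s-1      : s 1 ≈ p ×ₙ 1#
    s-+      : ∀ m n → s (m ℕ.+ n) ≈ s m * s n
    s-cancel : ∀ k {x y} → s k * x ≈ s k * y → x ≈ y

-- The ring R[1/p], where (z , m) stands for z / pᵐ.
module Localization {c ℓ : Level} (R : CommutativeRing c ℓ) (p : ℕ) (𝓢 : PowersOf R p) where

  open CommutativeRing R
  open PowersOf 𝓢
  open Mult semiring renaming (_×_ to _×ₙ_)
  open Exp semiring using (_^_)
  open RingProperties ring using (-‿distribʳ-*)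
  open NaturalCoefficients commutativeSemiring using (solve; _:=_; _:+_; _:*_)
  open SetoidReasoning setoid

  Frac : Set c
  Frac = Carrier × ℕ

  infix  4 _~_
  infixl 6 _+ᶠ_
  infixl 7 _*ᶠ_

  _~_ : Frac → Frac → Set ℓ
  (z , m) ~ (w , k) = s k * z ≈ s m * w

  _+ᶠ_ _*ᶠ_ : Frac → Frac → Frac
  (z , m) +ᶠ (w , k) = s k * z + s m * w , m ℕ.+ k
  (z , m) *ᶠ (w , k) = z * w , m ℕ.+ k

  -ᶠ_ : Frac → Frac
  -ᶠ (z , m) = - z , m

  ι : Carrier → Frac
  ι z = z , 0

  0ᶠ 1ᶠ : Frac
  0ᶠ = ι 0#
  1ᶠ = ι 1#

  ~-from : ∀ {z w m k} → z ≈ w → m ≡ k → (z , m) ~ (w , k)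
  ~-from z≈w ≡.refl = *-congˡ z≈w

  ~-trans : ∀ {x y v} → x ~ y → y ~ v → x ~ v
  ~-trans {z , m} {w , k} {v , l} x~y y~v = s-cancel k (begin
    s k * (s l * z)  ≈⟨ solve 3 (λ a b c → a :* (b :* c) := b :* (a :* c)) refl (s k) (s l) z ⟩
    s l * (s k * z)  ≈⟨ *-congˡ x~y ⟩
    s l * (s m * w)  ≈⟨ solve 3 (λ a b c → a :* (b :* c) := b :* (a :* c)) refl (s l) (s m) w ⟩
    s m * (s l * w)  ≈⟨ *-congˡ y~v ⟩
    s m * (s k * v)  ≈⟨ solve 3 (λ a b c → a :* (b :* c) := b :* (a :* c)) refl (s m) (s k) v ⟩
    s k * (s m * v)  ∎)

  +ᶠ-cong : ∀ {x x′ y y′} → x ~ x′ → y ~ y′ → x +ᶠ y ~ x′ +ᶠ y′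
  +ᶠ-cong {z , m} {z′ , m′} {w , k} {w′ , k′} x~x′ y~y′ = begin
    s (m′ ℕ.+ k′) * (s k * z + s m * w)
      ≈⟨ *-congʳ (s-+ m′ k′) ⟩
    s m′ * s k′ * (s k * z + s m * w)
      ≈⟨ solve 6 (λ a b c d z w → (c :* d) :* (b :* z :+ a :* w)
           := b :* d :* (c :* z) :+ a :* c :* (d :* w)) refl (s m) (s k) (s m′) (s k′) z w ⟩
    s k * s k′ * (s m′ * z) + s m * s m′ * (s k′ * w)
      ≈⟨ +-cong (*-congˡ x~x′) (*-congˡ y~y′) ⟩
    s k * s k′ * (s m * z′) + s m * s m′ * (s k * w′)
      ≈⟨ solve 6 (λ a b c d z w → b :* d :* (a :* z) :+ a :* c :* (b :* w)
           := (a :* b) :* (d :* z :+ c :* w)) refl (s m) (s k) (s m′) (s k′) z′ w′ ⟩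
    s m * s k * (s k′ * z′ + s m′ * w′)
      ≈⟨ *-congʳ (s-+ m k) ⟨
    s (m ℕ.+ k) * (s k′ * z′ + s m′ * w′) ∎

  *ᶠ-cong : ∀ {x x′ y y′} → x ~ x′ → y ~ y′ → x *ᶠ y ~ x′ *ᶠ y′
  *ᶠ-cong {z , m} {z′ , m′} {w , k} {w′ , k′} x~x′ y~y′ = begin
    s (m′ ℕ.+ k′) * (z * w)       ≈⟨ *-congʳ (s-+ m′ k′) ⟩
    s m′ * s k′ * (z * w)         ≈⟨ interchange _ _ _ _ ⟩
    (s m′ * z) * (s k′ * w)       ≈⟨ *-cong x~x′ y~y′ ⟩
    (s m * z′) * (s k * w′)       ≈⟨ interchange _ _ _ _ ⟨
    s m * s k * (z′ * w′)         ≈⟨ *-congʳ (s-+ m k) ⟨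
    s (m ℕ.+ k) * (z′ * w′)       ∎
    where
    interchange : ∀ a b z w → a * b * (z * w) ≈ (a * z) * (b * w)
    interchange = solve 4 (λ a b z w → a :* b :* (z :* w) := (a :* z) :* (b :* w)) refl

  -ᶠ-cong : ∀ {x y} → x ~ y → -ᶠ x ~ -ᶠ y
  -ᶠ-cong {z , m} {w , k} x~y =
    trans (sym (-‿distribʳ-* (s k) z)) (trans (-‿cong x~y) (-‿distribʳ-* (s m) w))

  +ᶠ-assoc : ∀ x y v → (x +ᶠ y) +ᶠ v ~ x +ᶠ (y +ᶠ v)
  +ᶠ-assoc (z , m) (w , k) (v , l) = ~-from (begin
    s l * (s k * z + s m * w) + s (m ℕ.+ k) * v
      ≈⟨ +-congˡ (*-congʳ (s-+ m k)) ⟩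
    s l * (s k * z + s m * w) + s m * s k * v
      ≈⟨ solve 6 (λ a b c z w v → c :* (b :* z :+ a :* w) :+ a :* b :* v
           := b :* c :* z :+ a :* (c :* w :+ b :* v)) refl (s m) (s k) (s l) z w v ⟩
    s k * s l * z + s m * (s l * w + s k * v)
      ≈⟨ +-congʳ (*-congʳ (s-+ k l)) ⟨
    s (k ℕ.+ l) * z + s m * (s l * w + s k * v) ∎) (ℕₚ.+-assoc m k l)

  +ᶠ-comm : ∀ x y → x +ᶠ y ~ y +ᶠ x
  +ᶠ-comm (z , m) (w , k) = ~-from (+-comm _ _) (ℕₚ.+-comm m k)

  +ᶠ-identityˡ : ∀ x → 0ᶠ +ᶠ x ~ x
  +ᶠ-identityˡ (z , m) = ~-from
    (trans (+-cong (zeroʳ _) (trans (*-congʳ s-0) (*-identityˡ z))) (+-identityˡ z)) ≡.refl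

  +ᶠ-inverseˡ : ∀ x → (-ᶠ x) +ᶠ x ~ 0ᶠ
  +ᶠ-inverseˡ (z , m) = begin
    s 0 * (s m * - z + s m * z)   ≈⟨ *-congˡ (distribˡ (s m) (- z) z) ⟨
    s 0 * (s m * (- z + z))       ≈⟨ *-congˡ (*-congˡ (-‿inverseˡ z)) ⟩
    s 0 * (s m * 0#)              ≈⟨ *-congˡ (zeroʳ _) ⟩
    s 0 * 0#                      ≈⟨ zeroʳ _ ⟩
    0#                            ≈⟨ zeroʳ _ ⟨
    s (m ℕ.+ m) * 0#              ∎

  *ᶠ-distribˡ : ∀ x y v → x *ᶠ (y +ᶠ v) ~ x *ᶠ y +ᶠ x *ᶠ v
  *ᶠ-distribˡ (z , m) (w , k) (v , l) = begin
    s ((m ℕ.+ k) ℕ.+ (m ℕ.+ l)) * (z * (s l * w + s k * v))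
      ≈⟨ *-congʳ (trans (s-+ (m ℕ.+ k) (m ℕ.+ l)) (*-cong (s-+ m k) (s-+ m l))) ⟩
    s m * s k * (s m * s l) * (z * (s l * w + s k * v))
      ≈⟨ solve 6 (λ a b c z w v → a :* b :* (a :* c) :* (z :* (c :* w :+ b :* v))
           := a :* (b :* c) :* (a :* c :* (z :* w) :+ a :* b :* (z :* v))) refl (s m) (s k) (s l) z w v ⟩
    s m * (s k * s l) * (s m * s l * (z * w) + s m * s k * (z * v))
      ≈⟨ *-cong (trans (s-+ m (k ℕ.+ l)) (*-congˡ (s-+ k l)))
           (+-cong (*-congʳ (s-+ m l)) (*-congʳ (s-+ m k))) ⟨
    s (m ℕ.+ (k ℕ.+ l)) * (s (m ℕ.+ l) * (z * w) + s (m ℕ.+ k) * (z * v)) ∎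

  frac-isCommutativeRing : IsCommutativeRing _~_ _+ᶠ_ _*ᶠ_ -ᶠ_ 0ᶠ 1ᶠ
  frac-isCommutativeRing = record
    { isRing = record
      { +-isAbelianGroup = record
        { isGroup = record
          { isMonoid = record
            { isSemigroup = record
              { isMagma = record
                { isEquivalence = record { refl = refl ; sym = sym ; trans = λ {x} {y} {v} → ~-trans {x} {y} {v} }
                ; ∙-cong = λ {x} {x′} {y} {y′} → +ᶠ-cong {x} {x′} {y} {y′}
                }
              ; assoc = +ᶠ-assoc
              }
            ; identity = +ᶠ-identityˡ , λ x →
                ~-trans {x +ᶠ 0ᶠ} {0ᶠ +ᶠ x} {x} (+ᶠ-comm x 0ᶠ) (+ᶠ-identityˡ x)
            }
          ; inverse = +ᶠ-inverseˡ , λ x →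
              ~-trans {x +ᶠ (-ᶠ x)} {(-ᶠ x) +ᶠ x} {0ᶠ} (+ᶠ-comm x (-ᶠ x)) (+ᶠ-inverseˡ x)
          ; ⁻¹-cong = λ {x} {y} → -ᶠ-cong {x} {y}
          }
        ; comm = +ᶠ-comm
        }
      ; *-cong     = λ {x} {x′} {y} {y′} → *ᶠ-cong {x} {x′} {y} {y′}
      ; *-assoc    = λ (z , m) (w , k) (v , l) → ~-from (*-assoc z w v) (ℕₚ.+-assoc m k l)
      ; *-identity = (λ (z , m) → ~-from (*-identityˡ z) ≡.refl) ,
                     (λ (z , m) → ~-from (*-identityʳ z) (ℕₚ.+-identityʳ m))
      ; distrib    = *ᶠ-distribˡ , λ v x y →
          ~-trans {(x +ᶠ y) *ᶠ v} {v *ᶠ (x +ᶠ y)} {x *ᶠ v +ᶠ y *ᶠ v} (*ᶠ-comm (x +ᶠ y) v)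
            (~-trans {v *ᶠ (x +ᶠ y)} {v *ᶠ x +ᶠ v *ᶠ y} {x *ᶠ v +ᶠ y *ᶠ v} (*ᶠ-distribˡ v x y)
              (+ᶠ-cong {v *ᶠ x} {x *ᶠ v} {v *ᶠ y} {y *ᶠ v} (*ᶠ-comm v x) (*ᶠ-comm v y)))
      }
    ; *-comm = *ᶠ-comm
    }
    where
    *ᶠ-comm : ∀ x y → x *ᶠ y ~ y *ᶠ x
    *ᶠ-comm (z , m) (w , k) = ~-from (*-comm z w) (ℕₚ.+-comm m k)

  fracRing : CommutativeRing c ℓ
  fracRing = record { isCommutativeRing = frac-isCommutativeRing }

  private module 𝔽 = CommutativeRing fracRing
  open Mult 𝔽.semiring using () renaming (_×_ to _×ᶠ_)
  open Exp 𝔽.semiring using () renaming (_^_ to _^ᶠ_)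

  ι-cong : ∀ {x y} → x ≈ y → ι x ~ ι y
  ι-cong x≈y = *-congˡ x≈y

  s0*x≈x : ∀ x → s 0 * x ≈ x
  s0*x≈x x = trans (*-congʳ s-0) (*-identityˡ x)

  ι-+ : ∀ x y → ι (x + y) ~ ι x +ᶠ ι y
  ι-+ x y = *-congˡ (sym (+-cong (s0*x≈x x) (s0*x≈x y)))

  ι-^ : ∀ n x → ι x ^ᶠ n ≡ ι (x ^ n)
  ι-^ zero    x = ≡.refl
  ι-^ (suc n) x = ≡.cong (ι x *ᶠ_) (ι-^ n x)

  -- Each `_+ᶠ_` multiplies the denominators, so an iterated sum has to be brought back to the
  -- denominator it started with.
  ×ᶠ-num : ∀ n z m → n ×ᶠ (z , m) ~ (n ×ₙ z , m)
  ×ᶠ-num zero    z m = trans (zeroʳ _) (sym (zeroʳ _))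
  ×ᶠ-num (suc n) z m = 𝔽.trans {suc n ×ᶠ (z , m)} {(z , m) +ᶠ (n ×ₙ z , m)} {suc n ×ₙ z , m}
    (+ᶠ-cong {z , m} {z , m} {n ×ᶠ (z , m)} {n ×ₙ z , m} refl (×ᶠ-num n z m)) (begin
      s m * (s m * z + s m * (n ×ₙ z))
        ≈⟨ solve 3 (λ a x y → a :* (a :* x :+ a :* y) := a :* a :* (x :+ y)) refl (s m) z (n ×ₙ z) ⟩
      s m * s m * (z + n ×ₙ z)
        ≈⟨ *-congʳ (s-+ m m) ⟨
      s (m ℕ.+ m) * (z + n ×ₙ z) ∎)

  -- The fractions z / p^m in p^k R, with denominators cleared. For k = 0 this is the image of R,
  -- matching `InZpQ`.
  Fᶠ : ℕ → Frac → Set (c ⊔ ℓ)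
  Fᶠ k (z , m) = ∃ λ w → z ≈ s m * (s k * w)

  p×≈s1* : ∀ z → p ×ₙ z ≈ s 1 * z
  p×≈s1* z = begin
    p ×ₙ z          ≈⟨ ×-congʳ p (*-identityˡ z) ⟨
    p ×ₙ (1# * z)   ≈⟨ ×-assoc-* p 1# z ⟨
    (p ×ₙ 1#) * z   ≈⟨ *-congʳ s-1 ⟨
    s 1 * z         ∎

  Fᶠ-resp : ∀ k {x y} → x ~ y → Fᶠ k x → Fᶠ k y
  Fᶠ-resp k {z , m} {z′ , m′} x~y (w , z≈) = w , s-cancel m (begin
    s m * z′                     ≈⟨ x~y ⟨
    s m′ * z                     ≈⟨ *-congˡ z≈ ⟩
    s m′ * (s m * (s k * w))     ≈⟨ solve 3 (λ a b c → a :* (b :* c) := b :* (a :* c)) refl _ _ _ ⟩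
    s m * (s m′ * (s k * w))     ∎)

  fracFiltration : Filtration fracRing p (c ⊔ ℓ)
  fracFiltration = record
    { F      = Fᶠ
    ; F-resp = λ k {x} {y} → Fᶠ-resp k {x} {y}
    ; F-0#   = λ k → 0# , sym (trans (*-congˡ (zeroʳ _)) (zeroʳ _))
    ; F-1#   = 1# , sym (trans (s0*x≈x _) (s0*x≈x _))
    ; F-+    = λ { k {z , m} {w , l} (a , z≈) (b , w≈) → a + b , (begin
        s l * z + s m * w
          ≈⟨ +-cong (*-congˡ z≈) (*-congˡ w≈) ⟩
        s l * (s m * (s k * a)) + s m * (s l * (s k * b))
          ≈⟨ solve 5 (λ l m k a b → l :* (m :* (k :* a)) :+ m :* (l :* (k :* b))
               := m :* l :* (k :* (a :+ b))) refl (s l) (s m) (s k) a b ⟩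
        s m * s l * (s k * (a + b))
          ≈⟨ *-congʳ (s-+ m l) ⟨
        s (m ℕ.+ l) * (s k * (a + b)) ∎) }
    ; F-neg  = λ { k {z , m} (a , z≈) → - a , (begin
        - z                    ≈⟨ -‿cong z≈ ⟩
        - (s m * (s k * a))    ≈⟨ -‿distribʳ-* _ _ ⟩
        s m * (- (s k * a))    ≈⟨ *-congˡ (-‿distribʳ-* _ _) ⟩
        s m * (s k * - a)      ∎) }
    ; F-*    = λ { k l {z , m} {w , n} (a , z≈) (b , w≈) → a * b , (begin
        z * w
          ≈⟨ *-cong z≈ w≈ ⟩
        s m * (s k * a) * (s n * (s l * b))
          ≈⟨ solve 6 (λ k l m n a b → m :* (k :* a) :* (n :* (l :* b))
               := m :* n :* (k :* l :* (a :* b))) refl (s k) (s l) (s m) (s n) a b ⟩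
        s m * s n * (s k * s l * (a * b))
          ≈⟨ *-cong (s-+ m n) (*-congʳ (s-+ k l)) ⟨
        s (m ℕ.+ n) * (s (k ℕ.+ l) * (a * b)) ∎) }
    ; F-pred = λ { k {z , m} (a , z≈) → s 1 * a , (begin
        z                          ≈⟨ z≈ ⟩
        s m * (s (suc k) * a)      ≈⟨ *-congˡ (*-congʳ (s-+ 1 k)) ⟩
        s m * (s 1 * s k * a)      ≈⟨ solve 4 (λ m o k a → m :* (o :* k :* a) := m :* (k :* (o :* a)))
                                        refl (s m) (s 1) (s k) a ⟩
        s m * (s k * (s 1 * a))    ∎) }
    ; F-p×   = λ { k {z , m} (a , z≈) → Fᶠ-resp (suc k) {p ×ₙ z , m} {p ×ᶠ (z , m)}
        (sym (×ᶠ-num p z m)) (a , (begin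
        p ×ₙ z                     ≈⟨ p×≈s1* z ⟩
        s 1 * z                    ≈⟨ *-congˡ z≈ ⟩
        s 1 * (s m * (s k * a))    ≈⟨ solve 4 (λ o m k a → o :* (m :* (k :* a)) := m :* (o :* k :* a))
                                        refl (s 1) (s m) (s k) a ⟩
        s m * (s 1 * s k * a)      ≈⟨ *-congˡ (*-congʳ (s-+ 1 k)) ⟨
        s m * (s (suc k) * a)      ∎)) }
    }

  Fᶠ-divide : ∀ k {x} → Fᶠ (suc k) (p ×ᶠ x) → Fᶠ k x
  Fᶠ-divide k {z , m} px∈ with Fᶠ-resp (suc k) {p ×ᶠ (z , m)} {p ×ₙ z , m} (×ᶠ-num p z m) px∈
  ... | a , pz≈ = a , s-cancel 1 (begin
    s 1 * z                    ≈⟨ p×≈s1* z ⟨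
    p ×ₙ z                     ≈⟨ pz≈ ⟩
    s m * (s (suc k) * a)      ≈⟨ *-congˡ (*-congʳ (s-+ 1 k)) ⟩
    s m * (s 1 * s k * a)      ≈⟨ solve 4 (λ o m k a → m :* (o :* k :* a) := o :* (m :* (k :* a)))
                                    refl (s 1) (s m) (s k) a ⟩
    s 1 * (s m * (s k * a))    ∎)

  open Filtered fracRing p fracFiltration using (_≡[_]_; differ-by; ≡[]-trans; ≡[]-reflexive)

  -- An integral fraction equals `ι w` for some w in R, so Fermat is inherited from R.
  fermatᶠ : (∀ x → ∃ λ d → x ^ p ≈ x + s 1 * d) → ∀ {x} → Fᶠ 0 x → x ^ᶠ p ≡[ 1 ] x
  fermatᶠ fermat {x@(z , m)} (w , z≈) =
    ≡[]-trans 1 {x ^ᶠ p} {ι (w ^ p)} {x}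
      (≡[]-reflexive 1 {x ^ᶠ p} {ι (w ^ p)}
        (≡.subst (x ^ᶠ p ~_) (ι-^ p w) (Exp.^-congˡ 𝔽.semiring p {x} {ι w} x~ιw)))
      (differ-by (ι (s 1 * d)) (d , sym (s0*x≈x _))
        (𝔽.trans {ι (w ^ p)} {ι w +ᶠ ι (s 1 * d)} {x +ᶠ ι (s 1 * d)}
          (𝔽.trans {ι (w ^ p)} {ι (w + s 1 * d)} {ι w +ᶠ ι (s 1 * d)}
            (ι-cong (proj₂ (fermat w))) (ι-+ w (s 1 * d)))
          (+ᶠ-cong {ι w} {x} {ι (s 1 * d)} {ι (s 1 * d)} (sym x~ιw) refl)))
    where
    d = proj₁ (fermat w)
    x~ιw : x ~ ι w
    x~ιw = trans (s0*x≈x z) (trans z≈ (*-congˡ (s0*x≈x w)))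

-- Integers modulo powers of p, and ℤ_p built from them.

module PAdic (p : ℕ) (pr : Prime p) where

  open ℤ using (ℤ; +_; -[1+_]; ∣_∣)

  private instance
    p≢0 : ℕ.NonZero p
    p≢0 = prime⇒nonZero pr

  ℤ-ring : CommutativeRing 0ℓ 0ℓ
  ℤ-ring = ℤP.+-*-commutativeRing

  private module ℤR = CommutativeRing ℤ-ring
  open Mult ℤR.semiring using () renaming (_×_ to _×ᶻ_)
  open Exp ℤR.semiring using (_^_; ^-congʳ; ^-assocʳ)

  +p^ : ℕ → ℤ
  +p^ k = + (p ℕ.^ k)

  +p^-+ : ∀ m k → +p^ (m ℕ.+ k) ≡ +p^ m ℤ.* +p^ k
  +p^-+ m k = ≡.trans (≡.cong +_ (ℕₚ.^-distribˡ-+-* p m k)) (ℤP.pos-* (p ℕ.^ m) (p ℕ.^ k))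

  +p^-suc : ∀ k → +p^ (suc k) ≡ + p ℤ.* +p^ k
  +p^-suc k = ℤP.pos-* p (p ℕ.^ k)

  +p^-nonZero : ∀ k → ℤ.NonZero (+p^ k)
  +p^-nonZero k = ℕₚ.m^n≢0 p k

  ×ᶻ-* : ∀ n x → n ×ᶻ x ≡ + n ℤ.* x
  ×ᶻ-* zero    x = ≡.sym (ℤP.*-zeroˡ x)
  ×ᶻ-* (suc n) x = ≡.trans (≡.cong (λ z → x ℤ.+ z) (×ᶻ-* n x)) (≡.sym (ℤP.suc-* (+ n) x))

  ℤ-filtration : Filtration ℤ-ring p 0ℓ
  ℤ-filtration = record
    { F      = λ k x → +p^ k ℤD.∣ x
    ; F-resp = λ { k ≡.refl d → d }
    ; F-0#   = λ k → divides (+ 0) ≡.refl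
    ; F-1#   = divides (+ 1) ≡.refl
    ; F-+    = λ k → ℤD.∣m∣n⇒∣m+n
    ; F-neg  = λ k → ℤD.∣m⇒∣-m
    ; F-*    = λ { k l (divides q ≡.refl) (divides r ≡.refl) → divides (q ℤ.* r)
        (≡.trans (interchange q r (+p^ k) (+p^ l)) (≡.cong (λ z → q ℤ.* r ℤ.* z) (≡.sym (+p^-+ k l)))) }
    ; F-pred = λ { k (divides q ≡.refl) → divides (q ℤ.* + p)
        (≡.trans (≡.cong (λ z → q ℤ.* z) (+p^-suc k)) (≡.sym (ℤP.*-assoc q (+ p) (+p^ k)))) }
    ; F-p×   = λ { k (divides q ≡.refl) → divides q
        (≡.trans (×ᶻ-* p _) (≡.trans (swap (+ p) q (+p^ k)) (≡.cong (λ z → q ℤ.* z) (≡.sym (+p^-suc k))))) }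
    }
    where
    interchange : ∀ q r a b → (q ℤ.* a) ℤ.* (r ℤ.* b) ≡ (q ℤ.* r) ℤ.* (a ℤ.* b)
    interchange = solve-∀
    swap : ∀ a q b → a ℤ.* (q ℤ.* b) ≡ q ℤ.* (a ℤ.* b)
    swap = solve-∀

  open Filtration ℤ-filtration
  open Filtered ℤ-ring p ℤ-filtration

  F0 : ∀ x → F 0 x
  F0 x = divides x (≡.sym (ℤP.*-identityʳ x))

  ∣⇒F-1 : ∀ {x} → p ℕD.∣ ∣ x ∣ → F 1 x
  ∣⇒F-1 {x} p∣x = ≡.subst (λ m → + m ℤD.∣ x) (≡.sym (ℕₚ.*-identityʳ p)) (∣ᵤ⇒∣ p∣x)

  F-1⇒∣ : ∀ {x} → F 1 x → p ℕD.∣ ∣ x ∣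
  F-1⇒∣ {x} x∈ = ∣⇒∣ᵤ (≡.subst (λ m → + m ℤD.∣ x) (ℕₚ.*-identityʳ p) x∈)

  ≡[0] : ∀ x y → x ≡[ 0 ] y
  ≡[0] x y = F⇒≡[] 0 (F0 _)

  *-congℤ : ∀ k {x y u v} → x ≡[ k ] y → u ≡[ k ] v → x ℤ.* u ≡[ k ] y ℤ.* v
  *-congℤ k = ≡[]-*-cong k (F0 _) (F0 _)

  ≡[]-drop : ∀ k n {x y} → x ≡[ k ℕ.+ n ] y → x ≡[ n ] y
  ≡[]-drop k n (differ-by d d∈ eq) = differ-by d (F-drop k n d∈) eq

  ^≡ : ∀ x n → x ^ n ≡ x ℤ.^ n
  ^≡ x zero    = ≡.refl
  ^≡ x (suc n) = ≡.cong (x ℤ.*_) (^≡ x n)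

  1^ : ∀ n → (+ 1) ^ n ≡ + 1
  1^ n = ≡.trans (^≡ (+ 1) n) (ℤP.^-zeroˡ n)

  0^ : ∀ n .{{_ : ℕ.NonZero n}} → (+ 0) ^ n ≡ + 0
  0^ (suc n) = ℤP.*-zeroˡ ((+ 0) ^ n)

  fermatℕ : ∀ n → (+ n) ^ p ≡[ 1 ] + n
  fermatℕ zero    = ≡[]-reflexive 1 (0^ p)
  fermatℕ (suc n) = ≡[]-trans 1 (freshman pr (F0 (+ 1)) (F0 (+ n)))
    (≡[]-+-cong 1 (≡[]-reflexive 1 (1^ p)) (fermatℕ n))

  -- For negative x = -(n + 1) the freshman's dream applied to x + (n + 1) = 0 gives 0 ≡ x^p + (n +
  -- 1). This avoids the sign (-1)^p and treats p = 2 like the odd primes.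
  fermatℤ : ∀ x → x ^ p ≡[ 1 ] x
  fermatℤ (+ n)        = fermatℕ n
  fermatℤ x@(-[1+ n ]) = ≡[]-trans 1 (≡[]-reflexive 1 (negate (x ^ p) (+ suc n)))
    (≡[]-+-cong 1 {v = x} (≡[]-trans 1 (≡[]-sym 1 x^p+[1+n]≡) (≡[]-reflexive 1 0^p)) (≡[]-reflexive 1 ≡.refl))
    where
    negate : ∀ a b → a ≡ (a ℤ.+ b) ℤ.+ ℤ.- b
    negate = solve-∀
    0^p : (x ℤ.+ + suc n) ^ p ≡ + 0
    0^p = ≡.trans (≡.cong (_^ p) (ℤP.+-inverseˡ (+ suc n))) (0^ p)
    x^p+[1+n]≡ : (x ℤ.+ + suc n) ^ p ≡[ 1 ] x ^ p ℤ.+ + suc n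
    x^p+[1+n]≡ = ≡[]-trans 1 (freshman pr (F0 x) (F0 (+ suc n)))
      (≡[]-+-cong 1 {x = x ^ p} (≡[]-reflexive 1 ≡.refl) (fermatℕ (suc n)))

  module _ {u : ℕ} (p∤u : ¬ (p ℕD.∣ u)) where

    u^[p-1]≡1 : (+ u) ^ pred p ≡[ 1 ] + 1
    u^[p-1]≡1 with euclidsLemma u ∣ (+ u) ^ pred p ℤ.- + 1 ∣ pr p∣
      where
      v-1 = (+ u) ^ pred p ℤ.- + 1
      factor : ∀ u v → u ℤ.* v ℤ.- u ≡ u ℤ.* (v ℤ.- + 1)
      factor = solve-∀
      p∣ : p ℕD.∣ u ℕ.* ∣ (+ u) ^ pred p ℤ.- + 1 ∣
      p∣ = ≡.subst (p ℕD.∣_) (ℤP.abs-* (+ u) v-1) (F-1⇒∣ (≡.subst (F 1)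
        (≡.trans (≡.cong (λ k → (+ u) ^ k ℤ.- + u) (≡.sym (ℕₚ.suc-pred p))) (factor (+ u) ((+ u) ^ pred p)))
        (≡[]⇒F 1 (fermatℤ (+ u)))))
    ... | inj₁ e = contradiction e p∤u
    ... | inj₂ e = F⇒≡[] 1 (∣⇒F-1 e)

    -- Euler's theorem: φ(p^(m+1)) = (p - 1) p^m, and taking m successive p-th powers lifts u^(p-1)
    -- ≡ 1 from modulus p to p^(m+1). At n = 0 the modulus is 1.
    u*invUnit≡1 : ∀ n → + u ℤ.* invUnit p u n ≡[ n ] + 1
    u*invUnit≡1 zero    = ≡[0] _ _
    u*invUnit≡1 (suc m) = ≡[]-trans (suc m) (≡[]-reflexive (suc m) euler)
      (≡[]-trans (suc m)
        (≡.subst (λ k → ((+ u) ^ pred p) ^ (p ℕ.^ m) ≡[ suc k ] (+ 1) ^ (p ℕ.^ m)) (ℕₚ.+-identityʳ m)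
          (^p^-cong m 0 (F0 (+ 1)) u^[p-1]≡1))
        (≡[]-reflexive (suc m) (1^ (p ℕ.^ m))))
      where
      φ = p ℕ.^ suc m ∸ p ℕ.^ m
      φ≡ : φ ≡ pred p ℕ.* p ℕ.^ m
      φ≡ = ≡.trans (≡.cong (p ℕ.^ suc m ∸_) (≡.sym (ℕₚ.*-identityˡ (p ℕ.^ m))))
        (≡.sym (ℕₚ.*-distribʳ-∸ (p ℕ.^ m) p 1))
      0<φ : 0 < φ
      0<φ = ℕₚ.m<n⇒0<n∸m (ℕₚ.^-monoʳ-< p (prime⇒1<p pr) (ℕₚ.n<1+n m))
      euler : + u ℤ.* invUnit p u (suc m) ≡ ((+ u) ^ pred p) ^ (p ℕ.^ m)
      euler = ≡.trans (≡.cong (+ u ℤ.*_) (≡.sym (^≡ (+ u) (φ ∸ 1))))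
        (≡.trans (^-congʳ (+ u) (ℕₚ.m+[n∸m]≡n 0<φ))
          (≡.trans (^-congʳ (+ u) φ≡) (≡.sym (^-assocʳ (+ u) (pred p) (p ℕ.^ m)))))

  -- Dividing by p^k costs k levels of precision.
  p^-cancel : ∀ k n {x y} → +p^ k ℤ.* x ≡[ k ℕ.+ n ] +p^ k ℤ.* y → x ≡[ n ] y
  p^-cancel k n {x} {y} p^x≡p^y = F⇒≡[] n
    (ℤD.*-cancelˡ-∣ (+p^ k) {{+p^-nonZero k}} (≡.subst₂ ℤD._∣_ (+p^-+ k n) (factor (+p^ k) x y)
      (≡[]⇒F (k ℕ.+ n) p^x≡p^y)))
    where
    factor : ∀ a x y → a ℤ.* x ℤ.- a ℤ.* y ≡ a ℤ.* (x ℤ.- y)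
    factor = solve-∀

  -- The ring of p-adic integers

  ℤₚ : Set
  ℤₚ = Σ Seq (IsZp p)

  seq : ℤₚ → Seq
  seq = proj₁

  coherent : ∀ (x : ℤₚ) n → seq x (suc n) ≡[ n ] seq x n
  coherent (x , x-coh) n = F⇒≡[] n (∣ᵤ⇒∣ (x-coh n))

  coherent-+ : ∀ (x : ℤₚ) k n → seq x (k ℕ.+ n) ≡[ n ] seq x n
  coherent-+ x zero    n = ≡[]-reflexive n ≡.refl
  coherent-+ x (suc k) n = ≡[]-trans n (≡[]-drop k n (coherent x (k ℕ.+ n))) (coherent-+ x k n)

  fromCoherent : ∀ (x : Seq) → (∀ n → x (suc n) ≡[ n ] x n) → IsZp p x
  fromCoherent x x-coh n = ∣⇒∣ᵤ (≡[]⇒F n (x-coh n))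

  infix 4 _≋_

  record _≋_ (x y : ℤₚ) : Set where
    constructor pointwise
    field
      at : ∀ n → seq x n ≡[ n ] seq y n

  open _≋_

  ≋⇒≈[p] : ∀ {x y} → x ≋ y → seq x ≈[ p ] seq y
  ≋⇒≈[p] x≋y n = ∣⇒∣ᵤ (≡[]⇒F n (at x≋y n))

  ≈[p]⇒≋ : ∀ {x y} → seq x ≈[ p ] seq y → x ≋ y
  ≈[p]⇒≋ x≈y = pointwise λ n → F⇒≡[] n (∣ᵤ⇒∣ (x≈y n))

  -- Opaque, so that conversion checking never unfolds coherence proofs.
  abstract

    const-coherent : ∀ c → IsZp p (const c)
    const-coherent c = fromCoherent (const c) (λ n → ≡[]-reflexive n ≡.refl)

    +-coherent : ∀ x y → IsZp p (seq x ⊕ seq y)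
    +-coherent x y = fromCoherent (seq x ⊕ seq y) (λ n → ≡[]-+-cong n (coherent x n) (coherent y n))

    *-coherent : ∀ x y → IsZp p (seq x ⊗ seq y)
    *-coherent x y = fromCoherent (seq x ⊗ seq y) (λ n → *-congℤ n (coherent x n) (coherent y n))

    neg-coherent : ∀ x → IsZp p (⊖ seq x)
    neg-coherent x = fromCoherent (⊖ seq x) (λ n → ≡[]-neg-cong n (coherent x n))

  infixl 6 _+ₚ_
  infixl 7 _*ₚ_

  fromℤ : ℤ → ℤₚ
  fromℤ c = const c , const-coherent c

  _+ₚ_ _*ₚ_ : ℤₚ → ℤₚ → ℤₚ
  x +ₚ y = seq x ⊕ seq y , +-coherent x y
  x *ₚ y = seq x ⊗ seq y , *-coherent x y

  -ₚ_ : ℤₚ → ℤₚ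
  -ₚ x = ⊖ seq x , neg-coherent x

  ≡⇒≋ : ∀ {x y} → (∀ n → seq x n ≡ seq y n) → x ≋ y
  ≡⇒≋ x≡y = pointwise λ n → ≡[]-reflexive n (x≡y n)

  ℤₚ-isCommutativeRing : IsCommutativeRing _≋_ _+ₚ_ _*ₚ_ -ₚ_ (fromℤ (+ 0)) (fromℤ (+ 1))
  ℤₚ-isCommutativeRing = record
    { isRing = record
      { +-isAbelianGroup = record
        { isGroup = record
          { isMonoid = record
            { isSemigroup = record
              { isMagma = record
                { isEquivalence = record
                  { refl  = ≡⇒≋ λ n → ≡.refl
                  ; sym   = λ d → pointwise λ n → ≡[]-sym n (at d n)
                  ; trans = λ d e → pointwise λ n → ≡[]-trans n (at d n) (at e n)
                  }
                ; ∙-cong = λ d e → pointwise λ n → ≡[]-+-cong n (at d n) (at e n)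
                }
              ; assoc = λ x y z → ≡⇒≋ λ n → ℤP.+-assoc (seq x n) (seq y n) (seq z n)
              }
            ; identity = (λ x → ≡⇒≋ λ n → ℤP.+-identityˡ (seq x n)) , (λ x → ≡⇒≋ λ n → ℤP.+-identityʳ (seq x n))
            }
          ; inverse = (λ x → ≡⇒≋ λ n → ℤP.+-inverseˡ (seq x n)) , (λ x → ≡⇒≋ λ n → ℤP.+-inverseʳ (seq x n))
          ; ⁻¹-cong = λ d → pointwise λ n → ≡[]-neg-cong n (at d n)
          }
        ; comm = λ x y → ≡⇒≋ λ n → ℤP.+-comm (seq x n) (seq y n)
        }
      ; *-cong     = λ d e → pointwise λ n → *-congℤ n (at d n) (at e n)
      ; *-assoc    = λ x y z → ≡⇒≋ λ n → ℤP.*-assoc (seq x n) (seq y n) (seq z n)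
      ; *-identity = (λ x → ≡⇒≋ λ n → ℤP.*-identityˡ (seq x n)) , (λ x → ≡⇒≋ λ n → ℤP.*-identityʳ (seq x n))
      ; distrib    = (λ x y z → ≡⇒≋ λ n → ℤP.*-distribˡ-+ (seq x n) (seq y n) (seq z n)) ,
                     (λ x y z → ≡⇒≋ λ n → ℤP.*-distribʳ-+ (seq x n) (seq y n) (seq z n))
      }
    ; *-comm = λ x y → ≡⇒≋ λ n → ℤP.*-comm (seq x n) (seq y n)
    }

  ℤₚ-ring : CommutativeRing 0ℓ 0ℓ
  ℤₚ-ring = record { isCommutativeRing = ℤₚ-isCommutativeRing }

  private module ℤₚR = CommutativeRing ℤₚ-ring
  open Mult ℤₚR.semiring using () renaming (_×_ to _×ₚ_)
  open Exp ℤₚR.semiring using () renaming (_^_ to _^ₚ_)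

  seq-× : ∀ m x n → seq (m ×ₚ x) n ≡ + m ℤ.* seq x n
  seq-× zero    x n = ≡.sym (ℤP.*-zeroˡ (seq x n))
  seq-× (suc m) x n = ≡.trans (≡.cong (λ z → seq x n ℤ.+ z) (seq-× m x n)) (≡.sym (ℤP.suc-* (+ m) (seq x n)))

  seq-^ : ∀ m x n → seq (x ^ₚ m) n ≡ seq x n ^ m
  seq-^ zero    x n = ≡.refl
  seq-^ (suc m) x n = ≡.cong (seq x n ℤ.*_) (seq-^ m x n)

  ℤₚ-powersOf : PowersOf ℤₚ-ring p
  ℤₚ-powersOf = record
    { s        = λ k → fromℤ (+p^ k)
    ; s-0      = ≡⇒≋ λ n → ≡.refl
    ; s-1      = ≡⇒≋ λ n → ≡.trans (ℤP.pos-* p 1) (≡.sym (seq-× p (fromℤ (+ 1)) n))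
    ; s-+      = λ m k → ≡⇒≋ λ n → +p^-+ m k
    -- The hypothesis is read at level k + n, where cancelling p^k still leaves level n; coherence
    -- brings both sides back to their n-th residues.
    ; s-cancel = λ k {x} {y} e → pointwise λ n → ≡[]-trans n (≡[]-sym n (coherent-+ x k n))
        (≡[]-trans n (p^-cancel k n (at e (k ℕ.+ n))) (coherent-+ y k n))
    }

  fermatₚ : ∀ x → ∃ λ d → x ^ₚ p ≋ x +ₚ fromℤ (+p^ 1) *ₚ d
  fermatₚ x = (d , fromCoherent d d-coh) , pointwise x^p≡
    where
    z = (x ^ₚ p) +ₚ (-ₚ x)
    z∈ : ∀ n → F 1 (seq z n)
    z∈ n = ≡[]⇒F 1 (≡[]-trans 1 (≡[]-reflexive 1 (seq-^ p x n)) (fermatℤ (seq x n)))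
    d : Seq
    -- A residue modulo p^(n+1) divided by p is determined only modulo p^n, hence the shift by one.
    d n = ℤD.quotient (z∈ (suc n))
    pd≡z : ∀ n → +p^ 1 ℤ.* d n ≡ seq z (suc n)
    pd≡z n = ≡.trans (ℤP.*-comm (+p^ 1) (d n)) (≡.sym (ℤD._∣_.equality (z∈ (suc n))))
    d-coh : ∀ n → d (suc n) ≡[ n ] d n
    d-coh n = p^-cancel 1 n (≡.subst₂ (λ a b → a ≡[ suc n ] b)
      (≡.sym (pd≡z (suc n))) (≡.sym (pd≡z n)) (coherent z (suc n)))
    add-back : ∀ a b → a ≡ b ℤ.+ (a ℤ.- b)
    add-back = solve-∀
    x^p≡ : ∀ n → seq (x ^ₚ p) n ≡[ n ] seq x n ℤ.+ +p^ 1 ℤ.* d n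
    x^p≡ n = ≡[]-trans n (≡[]-reflexive n (add-back (seq (x ^ₚ p) n) (seq x n)))
      (≡[]-+-cong n {x = seq x n} (≡[]-reflexive n ≡.refl)
        (≡[]-trans n (≡[]-sym n (coherent z n)) (≡[]-reflexive n (≡.sym (pd≡z n)))))

  invert : ∀ {u} → ¬ (p ℕD.∣ u) → ∃ λ (v : ℤₚ) → seq v ≡ invUnit p u × fromℤ (+ u) *ₚ v ≋ fromℤ (+ 1)
  invert {u} p∤u = (invUnit p u , fromCoherent (invUnit p u) v-coh) , ≡.refl , pointwise (u*invUnit≡1 p∤u)
    where
    v = invUnit p u
    rearrange : ∀ u v w → v ℤ.* (u ℤ.* w) ≡ (u ℤ.* v) ℤ.* w
    rearrange = solve-∀
    -- Coherence is uniqueness of inverses modulo p^n: v(n+1) ≡ v(n+1) · u · v(n) ≡ v(n).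
    v-coh : ∀ n → v (suc n) ≡[ n ] v n
    v-coh n =
      ≡[]-trans n (≡[]-reflexive n (≡.sym (ℤP.*-identityʳ (v (suc n)))))
        (≡[]-trans n (*-congℤ n {x = v (suc n)} (≡[]-reflexive n ≡.refl) (≡[]-sym n (u*invUnit≡1 p∤u n)))
          (≡[]-trans n (≡[]-reflexive n (rearrange (+ u) (v (suc n)) (v n)))
            (≡[]-trans n (*-congℤ n {u = v n} (≡[]-pred n (u*invUnit≡1 p∤u (suc n))) (≡[]-reflexive n ≡.refl))
              (≡[]-reflexive n (ℤP.*-identityˡ (v n))))))

-- Dividing a positive d by p > 1 makes it strictly smaller, so fuel f ≥ d cannot run out before the
-- part prime to p is reached.
splitP-correct : ∀ {p} → 1 < p → ∀ f d → d ≤ f → 0 < d →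
                 p ℕ.^ proj₁ (splitP p f d) ℕ.* proj₂ (splitP p f d) ≡ d × ¬ (p ℕD.∣ proj₂ (splitP p f d))
splitP-correct {p} 1<p (suc f) (suc d) (s≤s d≤f) _ with p ℕD.∣? suc d
... | no p∤d = ℕₚ.*-identityˡ (suc d) , p∤d
... | yes (ℕD.divides q@(suc _) d≡qp) = ≡.trans (ℕₚ.*-assoc p (p ℕ.^ v) u)
        (≡.trans (≡.cong (p ℕ.*_) (proj₁ ih)) (≡.trans (ℕₚ.*-comm p q) (≡.sym d≡qp)))
      , proj₂ ih
  where
  v = proj₁ (splitP p f q)
  u = proj₂ (splitP p f q)
  q≤d : q ≤ d
  q≤d = ℕₚ.≤-pred (≡.subst (q <_) (≡.sym d≡qp) (ℕₚ.m<m*n q p 1<p))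
  ih = splitP-correct 1<p f q (ℕₚ.≤-trans q≤d d≤f) (s≤s z≤n)

-- ℚ_p as ℤ_p[1/p] and its agreement with the encoding by raw sequences.

module Field (p : ℕ) (pr : Prime p) where

  open ℤ using (ℤ; +_)

  open PAdic p pr
  open CommutativeRing ℤₚ-ring using (semiring; commutativeSemiring)
    renaming (refl to ≋-refl; sym to ≋-sym; trans to ≋-trans; *-cong to *ₚ-cong; *-identityʳ to *ₚ-identityʳ)
  open Mult semiring using () renaming (_×_ to _×ₚ_)
  open NaturalCoefficients commutativeSemiring using (solve; _:=_; _:*_)
  open PowersOf ℤₚ-powersOf
  open Localization ℤₚ-ring p ℤₚ-powersOf
  open PowerSeries fracRing
  open FilteredSeries fracRing p fracFiltration
  open Filtered fracRing p fracFiltration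
  private module 𝔽 = CommutativeRing fracRing
  private module 𝕊 = CommutativeRing seriesRing
  open Mult 𝔽.semiring using () renaming (_×_ to _×ᶠ_)
  open Exp 𝕊.semiring using () renaming (_^_ to _^ₛ_)

  -- Forgets the coherence proof. The formulas for fractions are those of `addQ`, `mulQ` and `negQ`,
  -- so this map respects the operations by definition.
  toQp : Frac → Qp
  toQp (z , m) = seq z , m

  ×ₚ-* : ∀ n x → n ×ₚ x ≋ fromℤ (+ n) *ₚ x
  ×ₚ-* n x = ≡⇒≋ (seq-× n x)

  ι-ℕ : ∀ n → n ×ᶠ 1ᶠ ~ ι (fromℤ (+ n))
  ι-ℕ n = 𝔽.trans {n ×ᶠ 1ᶠ} {ι (n ×ₚ fromℤ (+ 1))} {ι (fromℤ (+ n))} (×ᶠ-num n (fromℤ (+ 1)) 0)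
    (ι-cong (≋-trans (×ₚ-* n (fromℤ (+ 1))) (*ₚ-identityʳ (fromℤ (+ n)))))

  module _ (d : ℕ) .{{d≢0 : ℕ.NonZero d}} where

    private
      v = proj₁ (splitP p d d)
      u = proj₂ (splitP p d d)
      correct : p ℕ.^ v ℕ.* u ≡ d × ¬ (p ℕD.∣ u)
      correct = splitP-correct (prime⇒1<p pr) d d ℕₚ.≤-refl (ℕ.>-nonZero⁻¹ d)
      inv = proj₁ (invert (proj₂ correct))

    divide : Frac → Frac
    divide (z , m) = z *ₚ inv , m ℕ.+ v

    toQp-divide : ∀ x → toQp (divide x) ≡ divNatQ p (toQp x) d
    toQp-divide x = ≡.refl

    ×-divide : ∀ x → d ×ᶠ divide x ~ x
    ×-divide (z , m) = 𝔽.trans {d ×ᶠ divide (z , m)} {d ×ₚ (z *ₚ inv) , m ℕ.+ v} {z , m}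
      (×ᶠ-num d (z *ₚ inv) (m ℕ.+ v))
      (≋-trans (*ₚ-cong (≋-refl {s m}) (≋-trans (×ₚ-* d (z *ₚ inv)) (*ₚ-cong d≋ (≋-refl {z *ₚ inv}))))
      (≋-trans (solve 5 (λ sm sv u z i → sm :* (sv :* u :* (z :* i)) := sm :* sv :* z :* (u :* i))
                  ≋-refl (s m) (s v) (fromℤ (+ u)) z inv)
      (≋-trans (*ₚ-cong (≋-refl {s m *ₚ s v *ₚ z}) (proj₂ (proj₂ (invert (proj₂ correct)))))
      (≋-trans (*ₚ-identityʳ (s m *ₚ s v *ₚ z))
        (*ₚ-cong (≋-sym (s-+ m v)) (≋-refl {z}))))))
      where
      d≋ : fromℤ (+ d) ≋ s v *ₚ fromℤ (+ u)
      d≋ = ≡⇒≋ λ n → ≡.trans (≡.cong +_ (≡.sym (proj₁ correct))) (ℤP.pos-* (p ℕ.^ v) u)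

  inverse : ∀ n → ∃ λ e → suc n ×ᶠ e ~ 1ᶠ
  inverse n = divide (suc n) 1ᶠ , ×-divide (suc n) 1ᶠ

  falling : Frac → ℕ → Frac
  falling α zero    = 1ᶠ
  falling α (suc n) = falling α n *ᶠ (α +ᶠ (-ᶠ ι (fromℤ (+ n))))

  binomial : Frac → ℕ → Frac
  binomial α n = divide (n !) {{n ℕₚ.!≢0}} (falling α n)

  toQp-falling : ∀ α n → toQp (falling α n) ≡ fallingQ p (toQp α) n
  toQp-falling α zero    = ≡.refl
  toQp-falling α (suc n) = ≡.cong (λ x → mulQ x (addQ p (toQp α) (negQ (natQ n)))) (toQp-falling α n)

  toQp-binomial : ∀ α n → toQp (binomial α n) ≡ binomQ p (toQp α) n
  toQp-binomial α n = ≡.trans (toQp-divide (n !) {{n ℕₚ.!≢0}} (falling α n))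
    (≡.cong (λ x → divNatQ p x (n !)) (toQp-falling α n))

  -- The abstract criterion writes the integer n as a multiple of 1, the encoding as a constant
  -- sequence.
  falling-suc : ∀ α n → falling α (suc n) ~ falling α n *ᶠ (α +ᶠ (-ᶠ (n ×ᶠ 1ᶠ)))
  falling-suc α n = 𝔽.*-congˡ {falling α n} {α +ᶠ (-ᶠ ι (fromℤ (+ n)))} {α +ᶠ (-ᶠ (n ×ᶠ 1ᶠ))}
    (𝔽.+-congˡ {α} { -ᶠ ι (fromℤ (+ n))} { -ᶠ (n ×ᶠ 1ᶠ)}
      (𝔽.-‿cong {ι (fromℤ (+ n))} {n ×ᶠ 1ᶠ} (𝔽.sym {n ×ᶠ 1ᶠ} {ι (fromℤ (+ n))} (ι-ℕ n))))

  toQp-sum : ∀ {t : ℕ → Frac} {u : ℕ → Qp} → (∀ k → toQp (t k) ≡ u k) →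
             ∀ n → toQp (sumUpTo t n) ≡ sumQ p u n
  toQp-sum t≡u zero    = t≡u 0
  toQp-sum t≡u (suc n) = ≡.cong₂ (addQ p) (toQp-sum t≡u n) (t≡u (suc n))

  sumZ-coherent : ∀ (t : ℕ → ℤₚ) n → IsZp p (sumZ (seq ∘ t) n)
  sumZ-coherent t zero    = proj₂ (t 0)
  sumZ-coherent t (suc n) = proj₂ ((sumZ (seq ∘ t) n , sumZ-coherent t n) +ₚ t (suc n))

  mul : Series ℤₚ → Series ℤₚ → Series ℤₚ
  mul f g n = mulS (seq ∘ f) (seq ∘ g) n , sumZ-coherent (λ i → f i *ₚ g (n ∸ i)) n

  powS-coherent : ∀ (f : Series ℤₚ) k n → IsZp p (powS (seq ∘ f) k n)

  pow : Series ℤₚ → ℕ → Series ℤₚ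
  pow f k n = powS (seq ∘ f) k n , powS-coherent f k n

  powS-coherent f zero    zero    = proj₂ (fromℤ (+ 1))
  powS-coherent f zero    (suc n) = proj₂ (fromℤ (+ 0))
  powS-coherent f (suc k) n       = proj₂ (mul (pow f k) f n)

  ι-sum : ∀ t n → ι (sumZ (seq ∘ t) n , sumZ-coherent t n) ~ sumUpTo (ι ∘ t) n
  ι-sum t zero    = ≋-refl
  ι-sum t (suc n) = 𝔽.trans {ι (sumₚ +ₚ t (suc n))} {ι sumₚ +ᶠ ι (t (suc n))} {sumUpTo (ι ∘ t) (suc n)}
    (ι-+ sumₚ (t (suc n))) (𝔽.+-congʳ {ι (t (suc n))} {ι sumₚ} {sumUpTo (ι ∘ t) n} (ι-sum t n))
    where sumₚ = sumZ (seq ∘ t) n , sumZ-coherent t n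

  ι-mul : ∀ f g → ι ∘ mul f g ≈ₛ (ι ∘ f) *ₛ (ι ∘ g)
  ι-mul f g n = 𝔽.trans {ι (mul f g n)} {sumUpTo (λ i → ι (f i) *ᶠ ι (g (n ∸ i))) n} {((ι ∘ f) *ₛ (ι ∘ g)) n}
    (ι-sum (λ i → f i *ₚ g (n ∸ i)) n) (convolution (ι ∘ f) (ι ∘ g) n)

  ι-pow : ∀ f k → ι ∘ pow f k ≈ₛ (ι ∘ f) ^ₛ k
  ι-pow f zero    zero    = ≋-refl
  ι-pow f zero    (suc n) = ≋-refl
  ι-pow f (suc k) = 𝕊.trans {ι ∘ mul (pow f k) f} {(ι ∘ pow f k) *ₛ (ι ∘ f)} {(ι ∘ f) ^ₛ suc k} (ι-mul (pow f k) f)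
    -- `powS` puts the new factor on the right, `_^ₛ_` on the left; commutativity reconciles them.
    (𝕊.trans {(ι ∘ pow f k) *ₛ (ι ∘ f)} {((ι ∘ f) ^ₛ k) *ₛ (ι ∘ f)} {(ι ∘ f) ^ₛ suc k}
      (𝕊.*-congʳ {ι ∘ f} {ι ∘ pow f k} {(ι ∘ f) ^ₛ k} (ι-pow f k)) (𝕊.*-comm ((ι ∘ f) ^ₛ k) (ι ∘ f)))

  Fᶠ-0⇔InZpQ : ∀ x → Fᶠ 0 x ⇔ InZpQ p (toQp x)
  Fᶠ-0⇔InZpQ (z , m) = mk⇔
    (λ (w , z≋) → seq w , proj₂ w , ≋⇒≈[p] (≋-trans z≋ (*ₚ-cong (≋-refl {s m}) (s0*x≈x w))))
    (λ (w , w-coh , z≈) → (w , w-coh) ,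
      ≋-trans (≈[p]⇒≋ {z} {s m *ₚ (w , w-coh)} z≈) (*ₚ-cong (≋-refl {s m}) (≋-sym (s0*x≈x (w , w-coh)))))

  ≡[]⇔∃ : ∀ k x y → ι x ≡[ k ] ι y ⇔
          (Σ Seq λ w → IsZp p w × ((seq x ⊕ (⊖ seq y)) ≈[ p ] (ppow p k ⊗ w)))
  ≡[]⇔∃ k x y = mk⇔
    (λ x≡y → let (w , x-y≋) = Fᶠ-resp k {ι x +ᶠ (-ᶠ ι y)} {ι (x +ₚ (-ₚ y))} (𝔽.sym {ι (x +ₚ (-ₚ y))} {ι x +ᶠ (-ᶠ ι y)} (ι-+ x (-ₚ y)))
                                (≡[]⇒F k {ι x} {ι y} x≡y)
             in seq w , proj₂ w , ≋⇒≈[p] (≋-trans x-y≋ (s0*x≈x (s k *ₚ w))))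
    (λ (w , w-coh , x-y≈) → F⇒≡[] k {ι x} {ι y}
      (Fᶠ-resp k {ι (x +ₚ (-ₚ y))} {ι x +ᶠ (-ᶠ ι y)} (ι-+ x (-ₚ y))
        ((w , w-coh) , ≋-trans (≈[p]⇒≋ {x +ₚ (-ₚ y)} {s k *ₚ (w , w-coh)} x-y≈)
          (≋-sym (s0*x≈x (s k *ₚ (w , w-coh)))))))

  -- The p^r-th root of the given series and its integrality.

  module _ (a : ℕ → Seq) (a-coh : ∀ n → IsZp p (a (suc n))) (r : ℕ) where

    private
      q = p ℕ.^ r

      f y h : Series ℤₚ
      f n = onePlus a n , coh n
        where
        coh : ∀ n → IsZp p (onePlus a n)
        coh zero    = proj₂ (fromℤ (+ 1))
        coh (suc n) = a-coh n
      y n = dropConst (onePlus a) n , coh n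
        where
        coh : ∀ n → IsZp p (dropConst (onePlus a) n)
        coh zero    = proj₂ (fromℤ (+ 0))
        coh (suc n) = a-coh n
      h n = f (n ℕ.* q)

      α : Frac
      α = fromℤ (+ 1) , r

      G : Series Frac
      G = comp (binomial α) (ι ∘ y)

      term : ℕ → ℕ → Frac
      term n k = binomial α k *ᶠ ι (pow y k n)

    -- `comp` takes powers of y among series of fractions, `powQS` among series of sequences;
    -- `ι-pow` matches them term by term.
    G~sum : ∀ n → G n ~ sumUpTo (term n) n
    G~sum n = 𝔽.trans {G n} {sumUpTo (λ k → binomial α k *ᶠ ((ι ∘ y) ^ₛ k) n) n} {sumUpTo (term n) n}
      (partial-sum (binomial α) (ι ∘ y) n n)
      (sumUpTo-cong-≤ n λ k _ → 𝔽.*-congˡ {binomial α k} {((ι ∘ y) ^ₛ k) n} {ι (pow y k n)}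
        (𝔽.sym {ι (pow y k n)} {((ι ∘ y) ^ₛ k) n} (ι-pow y k n)))

    toQp-root : ∀ n → toQp (sumUpTo (term n) n) ≡ powQS p (onePlus a) (invPpowQ r) n
    toQp-root n = toQp-sum (λ k → ≡.cong (λ b → mulQ b (ιQ (seq (pow y k n)))) (toQp-binomial α k)) n

    Integral⇔IntegralSeries : Integral G ⇔ IntegralSeries p (powQS p (onePlus a) (invPpowQ r))
    Integral⇔IntegralSeries = mk⇔
      (λ G∈ n → ≡.subst (InZpQ p) (toQp-root n)
        (to (Fᶠ-0⇔InZpQ (sumUpTo (term n) n)) (Fᶠ-resp 0 {G n} {sumUpTo (term n) n} (G~sum n) (G∈ n))))
      (λ G∈ n → Fᶠ-resp 0 {sumUpTo (term n) n} {G n} (𝔽.sym {G n} {sumUpTo (term n) n} (G~sum n))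
        (from (Fᶠ-0⇔InZpQ (sumUpTo (term n) n)) (≡.subst (InZpQ p) (≡.sym (toQp-root n)) (G∈ n))))
      where open Equivalence

    ≡ₛ⇔CongMod : ((ι ∘ f) ≡ₛ[ suc r ] ((ι ∘ h) ^ₛ q)) ⇔
                 CongMod p (suc r) (onePlus a) (powS (everyNth (onePlus a) q) q)
    ≡ₛ⇔CongMod = mk⇔
      (λ f≡h^q n → to (≡[]⇔∃ (suc r) (f n) (pow h q n))
        (≡[]-trans (suc r) (f≡h^q n) (≡[]-reflexive (suc r) {((ι ∘ h) ^ₛ q) n} {ι (pow h q n)}
          (𝔽.sym {ι (pow h q n)} {((ι ∘ h) ^ₛ q) n} (ι-pow h q n)))))
      (λ f≡h^q n → ≡[]-trans (suc r) (from (≡[]⇔∃ (suc r) (f n) (pow h q n)) (f≡h^q n))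
        (≡[]-reflexive (suc r) {ι (pow h q n)} {((ι ∘ h) ^ₛ q) n} (ι-pow h q n)))
      where open Equivalence

    criterion : Integral G ⇔ ((ι ∘ f) ≡ₛ[ suc r ] ((ι ∘ h) ^ₛ q))
    criterion = root-integrality pr (λ {x} → fermatᶠ fermatₚ {x}) (λ k {x} → Fᶠ-divide k {x}) inverse r {α} q×α~1
      {falling α} {binomial α} ≋-refl (falling-suc α) (λ n → ×-divide (n !) {{n ℕₚ.!≢0}} (falling α n))
      {ι ∘ y} {ι ∘ f} y₀~0 f~1+y f∈
      where
      q×α~1 : q ×ᶠ α ~ 1ᶠ
      q×α~1 = 𝔽.trans {q ×ᶠ α} {q ×ₚ fromℤ (+ 1) , r} {1ᶠ} (×ᶠ-num q (fromℤ (+ 1)) r)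
        (≋-trans (s0*x≈x (q ×ₚ fromℤ (+ 1))) (×ₚ-* q (fromℤ (+ 1))))
      y₀~0 : ι (y 0) ~ 0ᶠ
      y₀~0 = ι-cong (≡⇒≋ λ n → ≡.refl)
      f~1+y : ι ∘ f ≈ₛ 1ₛ +ₛ (ι ∘ y)
      f~1+y zero = 𝔽.trans {ι (f 0)} {ι (fromℤ (+ 1) +ₚ y 0)} {1ᶠ +ᶠ ι (y 0)}
        (ι-cong (≡⇒≋ λ n → ≡.refl)) (ι-+ (fromℤ (+ 1)) (y 0))
      f~1+y (suc n) = 𝔽.trans {ι (f (suc n))} {ι (fromℤ (+ 0) +ₚ y (suc n))} {0ᶠ +ᶠ ι (y (suc n))}
        (ι-cong (≡⇒≋ λ i → ≡.sym (ℤP.+-identityˡ (seq (y (suc n)) i)))) (ι-+ (fromℤ (+ 0)) (y (suc n)))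
      f∈ : Integral (ι ∘ f)
      f∈ n = f n , ≋-sym (≋-trans (s0*x≈x (s 0 *ₚ f n)) (s0*x≈x (f n)))

open import Data.Nat using (_^_)

theorem1 : (p : ℕ) → Prime p → (a : ℕ → Seq) → (∀ n → IsZp p (a (suc n))) →
    (r : ℕ) → 0 < r →
    IntegralSeries p (powQS p (onePlus a) (invPpowQ r))
    ⇔ CongMod p (suc r) (onePlus a) (powS (everyNth (onePlus a) (p ^ r)) (p ^ r))
theorem1 p pr a a-coh r _ =
  ⇔-trans (⇔-sym (Integral⇔IntegralSeries a a-coh r)) (⇔-trans (criterion a a-coh r) (≡ₛ⇔CongMod a a-coh r))
  where open Field p pr
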